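{- Let $n \geq 2$ be an integer and let $q \geq 3$ be a prime power. Let $G_{\mathrm{pr}}(\mathbb{F}_q^n)$ be the phase-rotation distance graph, and let $\alpha_2$ denote the $2$-independence number. Then \[ \alpha_2(G_{\mathrm{pr}}(\mathbb{F}_q^n)) \leq q^{n-2}\, \frac{n(n+1)+\lfloor \tfrac{n}{q} \rfloor q \big( -2-2n+q+ \lfloor \tfrac{n}{q} \rfloor q \big) }{ \big( n- \lfloor \tfrac{n}{q} \rfloor \big) \big( n+1-\lfloor \tfrac{n}{q} \rfloor \big)}. \]
   Context: Let $\mathbf{e}_1,\ldots,\mathbf{e}_n$ be the standard basis of $\mathbb{F}_q^n$ and $\mathbf{1}$ the all-ones vector. Put $F_i=\mathrm{span}(\mathbf{e}_i)$ for $i=1,\ldots,n$ and $F_{n+1}=\mathrm{span}(\mathbf{1})$. The phase-rotation weight of $\mathbf{x}\in\mathbb{F}_q^n$ is $w_{\mathrm{pr}}(\mathbf{x})=\min\{|I| : I\subseteq\{1,\ldots,n+1\},\ \mathbf{x}\in\mathrm{span}(\bigcup_{i\in I}F_i)\}$, and the phase-rotation distance is $d_{\mathrm{pr}}(\mathbf{x},\mathbf{y})=w_{\mathrm{pr}}(\mathbf{x}-\mathbf{y})$. The phase-rotation distance graph $G_{\mathrm{pr}}(\mathbb{F}_q^n)$ is the graph with vertex set $\mathbb{F}_q^n$ in which $\mathbf{x},\mathbf{y}$ are adjacent if and only if $d_{\mathrm{pr}}(\mathbf{x},\mathbf{y})=1$. For a graph $G$, the $k$-independence number $\alpha_k(G)$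 is the size of the largest set of vertices such that any two distinct vertices in the set are at geodesic distance greater than $k$ in $G$. -}

module Defs where

open import Algebra.Apartness.Bundles
  using (HeytingCommutativeRing; HeytingField)
open import Algebra.Bundles using (CommutativeRing)
import Algebra.Properties.Group as GroupProperties
import Algebra.Properties.Ring as RingProperties
open import Data.Bool.Base using (if_then_else_)
open import Data.Fin.Base using (Fin)
import Data.Fin.Properties as Finₚ
open import Data.Fin.Subset using (Subset; ∣_∣; _∈_)
import Data.Fin.Subset as Subset
open import Data.Fin.Subset.Properties using (∣⊥∣≡0)
open import Data.Integer.Base as ℤ using (ℤ; +_)
open import Data.Nat.Base as ℕ
  using (ℕ; suc; _≤_; _<_; _^_; _∸_; NonZero; z<s; >-nonZero)
open import Data.Nat.DivMod using (_/_; m/n<m)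
open import Data.Nat.Primality using (Prime)
import Data.Nat.Properties as ℕₚ
open import Data.Product.Base using (_×_; _,_; ∃-syntax; ∃₂; Σ-syntax)
open import Data.Rational.Base as ℚ using (ℚ)
open import Data.Vec.Functional using (Vector; replicate; zipWith; map; _++_)
import Data.Vec.Functional.Relation.Binary.Equality.Setoid as VectorEquality
open import Function.Bundles using (Injection; Inverse)
open import Level using (Level; _⊔_) renaming (suc to lsuc)
open import Relation.Binary.Bundles using (Setoid)
open import Relation.Binary.Core using (Rel)
open import Relation.Binary.PropositionalEquality.Core using (_≡_)
open import Relation.Binary.PropositionalEquality.Properties using (setoid)
open import Relation.Nullary.Decidable.Core using (does)
open import Relation.Nullary.Negation.Core using (¬_)
open import Relation.Unary using (Pred)

private
  variable
    a ℓ p : Level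

IsLeast : Pred ℕ p → Pred ℕ p
IsLeast P m = P m × (∀ {k} → P k → m ≤ k)

IsGreatest : Pred ℕ p → Pred ℕ p
IsGreatest P m = P m × (∀ {k} → P k → k ≤ m)

IsPrimePower : Pred ℕ _
IsPrimePower q = ∃₂ λ p k → Prime p × 1 ≤ k × q ≡ p ^ k

HasCardinality : Setoid a ℓ → ℕ → Set (a ⊔ ℓ)
HasCardinality S m = Inverse S (setoid (Fin m))

record Graph v ℓ e : Set (lsuc (v ⊔ ℓ ⊔ e)) where
  field
    vertices : Setoid v ℓ

  open Setoid vertices public
    using (_≈_; _≉_) renaming (Carrier to Vertex)

  field
    Adjacent   : Rel Vertex e
    adj-resp-≈ : ∀ {u u′ v v′} → u ≈ u′ → v ≈ v′ → Adjacent u v → Adjacent u′ v′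
    adj-sym    : ∀ {u v} → Adjacent u v → Adjacent v u
    adj-irrefl : ∀ {u v} → u ≈ v → ¬ Adjacent u v

module _ {v ℓ e} (G : Graph v ℓ e) where
  open Graph G

  data Walk : Vertex → Vertex → ℕ → Set (v ⊔ ℓ ⊔ e) where
    nil  : ∀ {u w} → u ≈ w → Walk u w 0
    cons : ∀ {u x w l} → Adjacent u x → Walk x w l → Walk u w (suc l)

  IsGeodesicDistance : Vertex → Vertex → Pred ℕ _
  IsGeodesicDistance u w = IsLeast (Walk u w)

  -- Vertices in different components have no geodesic distance in ℕ; they
  -- are at distance ∞, which exceeds every k, so the condition is vacuous.
  DistanceExceeds : ℕ → Rel Vertex _
  DistanceExceeds k u w = ∀ d → IsGeodesicDistance u w d → k < d

  -- A set of m vertices is given by an injective enumeration.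
  VertexSet : ℕ → Set _
  VertexSet m = Injection (setoid (Fin m)) vertices

  IsIndependent : ℕ → ∀ {m} → VertexSet m → Set _
  IsIndependent k S = ∀ i j → S.to i ≉ S.to j → DistanceExceeds k (S.to i) (S.to j)
    where module S = Injection S

  IsIndependenceNumber : ℕ → Pred ℕ _
  IsIndependenceNumber k = IsGreatest λ m → Σ[ S ∈ VertexSet m ] IsIndependent k S

-- When the carrier is finite, its equality and invertibility are decidable,
-- so the Heyting field axioms amount to the usual field axioms, the
-- apartness being necessarily the negation of equality.

module PhaseRotation {c ℓ₁ ℓ₂} (F : HeytingField c ℓ₁ ℓ₂) (n : ℕ) where
  open HeytingField F hiding (zero)
  open VectorEquality (HeytingField.setoid F) using (≋-setoid)
  open Setoid (≋-setoid n) public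
    using () renaming (Carrier to V; _≈_ to _≋_)

  infixl 6 _+ᵛ_ _-ᵛ_
  infixr 7 _*ᵛ_

  0ᵛ : V
  0ᵛ = replicate n 0#

  1ᵛ : V
  1ᵛ = replicate n 1#

  _+ᵛ_ _-ᵛ_ : V → V → V
  _+ᵛ_ = zipWith _+_
  _-ᵛ_ = zipWith _-_

  _*ᵛ_ : Carrier → V → V
  s *ᵛ x = map (s *_) x

  basis : Fin n → V
  basis i j = if does (i Finₚ.≟ j) then 1# else 0#

  data Span {p} (S : Pred V p) : Pred V (c ⊔ ℓ₁ ⊔ p) where
    generator : ∀ {x} → S x → Span S x
    zero      : Span S 0ᵛ
    add       : ∀ {x y} → Span S x → Span S y → Span S (x +ᵛ y)
    scale     : ∀ s {x} → Span S x → Span S (s *ᵛ x)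
    resp      : ∀ {x y} → x ≋ y → Span S x → Span S y

  -- The index i ∈ Fin (n + 1) stands for i + 1 in {1, …, n + 1}.
  𝓕 : Vector (Pred V (c ⊔ ℓ₁)) (n ℕ.+ 1)
  𝓕 = (λ i → Span (_≋ basis i)) ++ (λ (_ : Fin 1) → Span (_≋ 1ᵛ))

  ⋃𝓕 : Subset (n ℕ.+ 1) → Pred V (c ⊔ ℓ₁)
  ⋃𝓕 I x = ∃[ i ] i ∈ I × 𝓕 i x

  IsWeight : V → Pred ℕ _
  IsWeight x = IsLeast λ m → ∃[ I ] ∣ I ∣ ≡ m × Span (⋃𝓕 I) x

  IsDistance : V → V → Pred ℕ _
  IsDistance x y = IsWeight (x -ᵛ y)

  private
    module C = CommutativeRing
      (HeytingCommutativeRing.commutativeRing heytingCommutativeRing)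
    module R = RingProperties C.ring
    module G = GroupProperties C.+-group

    flip-- : ∀ s t → - 1# * (s - t) ≈ t - s
    flip-- s t = trans (R.-1*x≈-x (s - t))
      (trans (G.⁻¹-anti-homo-∙ s (- t)) (+-congʳ (G.⁻¹-involutive t)))

    weight-resp : ∀ {x y m} → (∀ {I} → Span (⋃𝓕 I) x → Span (⋃𝓕 I) y) →
                  (∀ {I} → Span (⋃𝓕 I) y → Span (⋃𝓕 I) x) →
                  IsWeight x m → IsWeight y m
    weight-resp f g ((I , |I|≡m , x∈) , least) =
      (I , |I|≡m , f x∈) , λ (J , |J|≡k , y∈) → least (J , |J|≡k , g y∈)

    weight-resp-≋ : ∀ {x y m} → x ≋ y → IsWeight x m → IsWeight y m
    weight-resp-≋ x≋y = weight-resp (resp x≋y) (resp λ i → sym (x≋y i))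

    span-flip : ∀ {p} {S : Pred V p} x y → Span S (x -ᵛ y) → Span S (y -ᵛ x)
    span-flip x y x-y∈ = resp (λ i → flip-- (x i) (y i)) (scale (- 1#) x-y∈)

  graph : Graph c ℓ₁ (c ⊔ ℓ₁)
  graph = record
    { vertices   = ≋-setoid n
    ; Adjacent   = λ x y → IsDistance x y 1
    ; adj-resp-≈ = λ x≋x′ y≋y′ →
        weight-resp-≋ λ i → +-cong (x≋x′ i) (-‿cong (y≋y′ i))
    ; adj-sym    = λ {x} {y} →
        weight-resp (span-flip x y) (span-flip y x)
    ; adj-irrefl = λ {x} {y} x≋y (_ , least) →
        ℕₚ.1+n≰n (least
          ( Subset.⊥ , ∣⊥∣≡0 (n ℕ.+ 1)
          , resp (λ i → sym (trans (+-congʳ (x≋y i)) (-‿inverseʳ (y i)))) zero))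
    }

-- As 2 ≤ n and 3 ≤ q, also n / q < n, so no subtraction in ℕ truncates.
module _ (n q : ℕ) (2≤n : 2 ≤ n) (3≤q : 3 ≤ q) where
  open import Data.Nat.Base using (_+_; _*_)

  private
    instance
      n-nonZero : NonZero n
      n-nonZero = >-nonZero (ℕₚ.<-≤-trans z<s 2≤n)

      q-nonZero : NonZero q
      q-nonZero = >-nonZero (ℕₚ.<-≤-trans z<s 3≤q)

    f : ℕ
    f = n / q

    f<n : f < n
    f<n = m/n<m n q (ℕₚ.<⇒≤ 3≤q)

  numerator : ℤ
  numerator = + (n * (n + 1)) ℤ.+
    + (f * q) ℤ.* (ℤ.- + 2 ℤ.- + (2 * n) ℤ.+ + q ℤ.+ + (f * q))

  denominator : ℕ
  denominator = (n ∸ f) * (n + 1 ∸ f)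

  instance
    denominator-nonZero : NonZero denominator
    denominator-nonZero = ℕₚ.m*n≢0 (n ∸ f) (n + 1 ∸ f)
      {{>-nonZero (ℕₚ.m<n⇒0<n∸m f<n)}}
      {{>-nonZero (ℕₚ.m<n⇒0<n∸m (ℕₚ.<-≤-trans f<n (ℕₚ.m≤m+n n 1)))}}

  bound : ℚ
  bound = (+ (q ^ (n ∸ 2)) ℚ./ 1) ℚ.* (numerator ℚ./ denominator)

{-# OPTIONS --safe #-}
module Submission where

-- Let N = n + 1, and extend vectors by a last coordinate 0. For a ∈ F^N with
-- coordinate sum 0, let Z(a) be the number of zero coordinates of a and put
-- W(a) = (Z(a) − f)(Z(a) − f − 1) with f = ⌊n/q⌋; this is nonnegative, since
-- Z(a) and f are integers. For a 2-independent set C of size m, put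
-- K(a) = Σ_{x,y ∈ C} (q [⟨x,a⟩ = ⟨y,a⟩] − 1), which is nonnegative by
-- Cauchy–Schwarz. If x ≠ y in C, then x − y does not lie in the span of two of
-- the lines F_k, F_l, so its extension takes different values at two coordinates
-- p, r ∉ {k, l}. Adding multiples of e_p − e_r to a then changes neither a_k
-- nor a_l and makes ⟨x − y, a⟩ uniformly distributed, so the pair (x, y)
-- contributes 0 to Σ_a W(a) K(a). Hence Σ W K = m (q − 1) Σ W, while the term
-- a = 0 alone is (N − f)(N − f − 1) m² (q − 1). The same shifts give
-- Σ W from the first two moments of Z. This is the ratio bound, the eigenvalues
-- of the graph being q Z(a) − N, but without characters.

open import Defs
open import Algebra.Apartness.Bundles using (HeytingCommutativeRing; HeytingField)
open import Algebra.Bundles using (CommutativeRing)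
import Algebra.Properties.AbelianGroup as AbelianGroupProperties
import Algebra.Properties.CommutativeSemigroup as CommutativeSemigroupProperties
import Algebra.Properties.Ring as RingProperties
open import Data.Bool.Base using (if_then_else_; true; false)
open import Data.Fin.Base as Fin using (Fin; zero; suc; combine; _↑ˡ_; _↑ʳ_; splitAt)
import Data.Fin.Permutation as Perm
import Data.Fin.Properties as Finₚ
open import Data.Fin.Subset as Subset using (Subset; outside; ∣_∣; ⁅_⁆)
open import Data.Fin.Subset.Properties using (x∈⁅x⁆; ∣⁅x⁆∣≡1)
open import Data.Integer.Base as ℤ using (ℤ; +_; -[1+_]; 0ℤ; 1ℤ; +≤+; +<+; positive)
import Data.Integer.Properties as ℤₚ
open import Data.Integer.Tactic.RingSolver using (solve-∀)
open import Data.Nat.Base as ℕ using (ℕ; _≤_; z≤n; s≤s)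
open import Data.Nat.DivMod using (_/_; m/n≤m)
import Data.Nat.Properties as ℕₚ
open import Data.Product.Base using (_×_; _,_; ∃-syntax; ∃₂; proj₁)
open import Data.Rational.Base as ℚ using ()
import Data.Rational.Properties as ℚₚ
open import Data.Rational.Unnormalised.Base as ℚᵘ using (mkℚᵘ; *≤*)
import Data.Rational.Unnormalised.Properties as ℚᵘₚ
open import Data.Sum.Base using (_⊎_; inj₁; inj₂)
open import Data.Vec.Base using (_∷_; there)
open import Data.Vec.Functional using (Vector; updateAt; _++_)
import Data.Vec.Functional.Properties as Vecₚ
import Data.Vec.Functional.Relation.Binary.Equality.Setoid as VectorEquality
open import Function.Base using (_∘_)
open import Function.Bundles using (Injection; Inverse)
open import Relation.Binary.Bundles using (Setoid)
open import Relation.Binary.PropositionalEquality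
  using (_≡_; _≢_; _≗_; refl; sym; trans; cong; cong₂; module ≡-Reasoning)
import Relation.Binary.Reasoning.Setoid as SetoidReasoning
open import Relation.Nullary.Decidable using (Dec; does; yes; no; dec-true; decidable-stable)
open import Relation.Nullary.Negation using (¬_; contradiction)

-- Distance in the phase-rotation graph

∣p∣≡0⇒∉ : ∀ {n} (p : Subset n) → ∣ p ∣ ≡ 0 → ∀ i → ¬ i Subset.∈ p
∣p∣≡0⇒∉ (outside ∷ p) ∣p∣≡0 (suc i) (there i∈p) = ∣p∣≡0⇒∉ p ∣p∣≡0 i i∈p

-- With `N = n + 1` the hypothesis `3 ≤ N` is `2 ≤ n`. In the counting below, the coordinate outside
-- the pair absorbs the change that keeps the coordinate sum at 0.
third : ∀ {N} → 3 ≤ N → ∀ (k l : Fin N) → ∃[ p ] p ≢ k × p ≢ l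
third (s≤s (s≤s (s≤s _))) zero          zero          = suc zero , (λ ()) , (λ ())
third (s≤s (s≤s (s≤s _))) zero          (suc zero)    = suc (suc zero) , (λ ()) , (λ ())
third (s≤s (s≤s (s≤s _))) zero          (suc (suc _)) = suc zero , (λ ()) , (λ ())
third (s≤s (s≤s (s≤s _))) (suc zero)    zero          = suc (suc zero) , (λ ()) , (λ ())
third (s≤s (s≤s (s≤s _))) (suc (suc _)) zero          = suc zero , (λ ()) , (λ ())
third (s≤s (s≤s (s≤s _))) (suc _)       (suc _)       = zero , (λ ()) , (λ ())

initial⊎last : ∀ {n} (k : Fin (n ℕ.+ 1)) → (∃[ i ] k ≡ i ↑ˡ 1) ⊎ (k ≡ n ↑ʳ zero)
initial⊎last {n} k with splitAt n k in eq
... | inj₁ i    = inj₁ (i , sym (Finₚ.splitAt⁻¹-↑ˡ eq))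
... | inj₂ zero = inj₂ (sym (Finₚ.splitAt⁻¹-↑ʳ eq))

last≢initial : ∀ {n} (i : Fin n) → n ↑ʳ zero ≢ i ↑ˡ 1
last≢initial {n} i eq
  with trans (sym (Finₚ.splitAt-↑ʳ n 1 zero)) (trans (cong (splitAt n) eq) (Finₚ.splitAt-↑ˡ n i 1))
... | ()

module Geometry {c ℓ₁ ℓ₂} (F : HeytingField c ℓ₁ ℓ₂) (n : ℕ) where
  open PhaseRotation F n
  private
    module F = HeytingField F
    R : CommutativeRing c ℓ₁
    R = HeytingCommutativeRing.commutativeRing F.heytingCommutativeRing
    module R = CommutativeRing R
    open AbelianGroupProperties R.+-abelianGroup
      using (⁻¹-anti-homo‿-; xyx⁻¹≈y; x∙y⁻¹≈ε⇒x≈y)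
    open Graph graph using (Adjacent)
    open R using (Carrier; _≈_; 0#; 1#; _+_; _*_; _-_; -_)

  direction : Fin (n ℕ.+ 1) → V
  direction = basis ++ (λ _ → 1ᵛ)

  direction∈𝓕 : ∀ k → 𝓕 k (direction k)
  direction∈𝓕 k with splitAt n k
  ... | inj₁ i = generator λ _ → R.refl
  ... | inj₂ i = generator λ _ → R.refl

  span-empty : ∀ {p} {S : V → Set p} → (∀ x → ¬ S x) → ∀ {x} → Span S x → x ≋ 0ᵛ
  span-empty S-empty (generator x∈S)  = contradiction x∈S (S-empty _)
  span-empty S-empty zero             = λ _ → R.refl
  span-empty S-empty (add x∈ y∈)      = λ i →
    R.trans (R.+-cong (span-empty S-empty x∈ i) (span-empty S-empty y∈ i)) (R.+-identityˡ 0#)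
  span-empty S-empty (scale s x∈)     = λ i →
    R.trans (R.*-congˡ (span-empty S-empty x∈ i)) (R.zeroʳ s)
  span-empty S-empty (resp x≋y x∈)    = λ i →
    R.trans (R.sym (x≋y i)) (span-empty S-empty x∈ i)

  -- The singleton `⁅ k ⁆` witnesses weight one. Weight zero would put `x -ᵛ y` in the span of an
  -- empty union and so make it zero.
  adjacent : ∀ {x y} s k → (x -ᵛ y) ≋ (s *ᵛ direction k) → ¬ x ≋ y → Adjacent x y
  adjacent {x} {y} s k x-y≋ x≉y =
    ( ⁅ k ⁆ , ∣⁅x⁆∣≡1 k
    , resp (λ i → R.sym (x-y≋ i)) (scale s (generator (k , x∈⁅x⁆ k , direction∈𝓕 k))))
    , λ { {ℕ.zero} (I , ∣I∣≡0 , x-y∈) → contradiction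
            (λ i → x∙y⁻¹≈ε⇒x≈y (x i) (y i)
              (span-empty (λ _ (i , i∈I , _) → ∣p∣≡0⇒∉ I ∣I∣≡0 i i∈I) x-y∈ i))
            x≉y
        ; {ℕ.suc _} _ → s≤s z≤n }

  -- The midpoint `u` gives a walk of length two. No case distinction on `s` and `t` is made to see
  -- that `u` differs from both ends: if it equalled one of them, `x` and `y` would be adjacent, and
  -- `2<dist` excludes walks of length one.
  not-exceeds-two : ∀ {x y} s t k l → (x -ᵛ y) ≋ ((s *ᵛ direction k) +ᵛ (t *ᵛ direction l)) →
                    ¬ x ≋ y → ¬ DistanceExceeds graph 2 x y
  not-exceeds-two {x} {y} s t k l x-y≋ x≉y 2<dist = ℕₚ.<-irrefl refl (2<dist 2 (walk₂ , least))
    where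
    ¬walk₀ : ¬ Walk graph x y 0
    ¬walk₀ (nil x≋y) = x≉y x≋y

    -- `2<dist` speaks of least lengths only, so a walk contradicts it only once all shorter walks
    -- are excluded.
    ¬walk₁ : ¬ Walk graph x y 1
    ¬walk₁ w = ℕₚ.<⇒≱ (2<dist 1 (w , λ { {ℕ.zero} w₀ → contradiction w₀ ¬walk₀
                                          ; {ℕ.suc _} _ → s≤s z≤n }))
                       (s≤s z≤n)

    least : ∀ {d} → Walk graph x y d → 2 ≤ d
    least {ℕ.zero}          w = contradiction w ¬walk₀
    least {ℕ.suc ℕ.zero}    w = contradiction w ¬walk₁
    least {ℕ.suc (ℕ.suc _)} w = s≤s (s≤s z≤n)

    u : V
    u = x -ᵛ (s *ᵛ direction k)

    x-u : (x -ᵛ u) ≋ (s *ᵛ direction k)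
    x-u i = begin
      x i - (x i - a)   ≈⟨ R.+-congˡ (⁻¹-anti-homo‿- (x i) a) ⟩
      x i + (a - x i)   ≈⟨ R.+-assoc (x i) a (- x i) ⟨
      x i + a - x i     ≈⟨ xyx⁻¹≈y (x i) a ⟩
      a                 ∎
      where
      open SetoidReasoning R.setoid
      a = s * direction k i

    u-y : (u -ᵛ y) ≋ (t *ᵛ direction l)
    u-y i = begin
      x i - a - y i       ≈⟨ R.+-assoc (x i) (- a) (- y i) ⟩
      x i + (- a - y i)   ≈⟨ R.+-congˡ (R.+-comm (- a) (- y i)) ⟩
      x i + (- y i - a)   ≈⟨ R.+-assoc (x i) (- y i) (- a) ⟨
      x i - y i - a       ≈⟨ R.+-congʳ (x-y≋ i) ⟩
      a + b - a           ≈⟨ xyx⁻¹≈y a b ⟩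
      b                   ∎
      where
      open SetoidReasoning R.setoid
      a = s * direction k i
      b = t * direction l i

    x≉u : ¬ x ≋ u
    x≉u x≋u = ¬walk₁ (cons
      (adjacent t l (λ i → R.trans (R.+-congʳ (x≋u i)) (u-y i)) x≉y) (nil λ _ → R.refl))

    u≉y : ¬ u ≋ y
    u≉y u≋y = ¬walk₁ (cons
      (adjacent s k (λ i → R.trans (R.+-congˡ (R.-‿cong (R.sym (u≋y i)))) (x-u i)) x≉y)
      (nil λ _ → R.refl))

    walk₂ : Walk graph x y 2
    walk₂ = cons (adjacent s k x-u x≉u) (cons (adjacent t l u-y u≉y) (nil λ _ → R.refl))

  -- Homogeneous coordinates: modulo the all-ones vector of length n + 1 the
  -- last unit vector is −1ᵛ, so all n + 1 lines look alike.
  extend : V → Vector Carrier (n ℕ.+ 1)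
  extend x = x ++ (λ _ → 0#)

  -- Let e be the common value of `d` off {k, l}. Subtracting e times the all-ones vector leaves a
  -- vector supported on {k, l}. The last coordinate is 0, so e = 0 when the last index is off the
  -- pair; otherwise e is the coefficient of `1ᵛ`.
  two-directions : 3 ≤ n ℕ.+ 1 → ∀ (d : Vector Carrier (n ℕ.+ 1)) → d (n ↑ʳ zero) ≈ 0# →
    ∀ {k l} → k ≢ l →
    (∀ p r → p ≢ k × p ≢ l → r ≢ k × r ≢ l → d p ≈ d r) →
    ∃₂ λ s t → (d ∘ (_↑ˡ 1)) ≋ ((s *ᵛ direction k) +ᵛ (t *ᵛ direction l))
  two-directions 3≤N d d-last {k} {l} k≢l const = go (initial⊎last k) (initial⊎last l)
    where
    open SetoidReasoning R.setoid
    Combination : Fin (n ℕ.+ 1) → Fin (n ℕ.+ 1) → Set _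
    Combination k l = ∃₂ λ s t → (d ∘ (_↑ˡ 1)) ≋ ((s *ᵛ direction k) +ᵛ (t *ᵛ direction l))

    swap : ∀ {k l} → Combination k l → Combination l k
    swap (s , t , eq) = t , s , λ i → R.trans (eq i) (R.+-comm _ _)

    direction-initial : ∀ i j → direction (i ↑ˡ 1) j ≈ basis i j
    direction-initial i j =
      R.reflexive (cong (λ v → v j) (Vecₚ.lookup-++ˡ basis (λ (_ : Fin 1) → 1ᵛ) i))

    direction-last : ∀ j → direction (n ↑ʳ zero) j ≈ 1#
    direction-last j =
      R.reflexive (cong (λ v → v j) (Vecₚ.lookup-++ʳ basis (λ (_ : Fin 1) → 1ᵛ) zero))

    ↑ˡ-≢ : ∀ {i j : Fin n} → i ≢ j → i ↑ˡ 1 ≢ j ↑ˡ 1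
    ↑ˡ-≢ i≢j = i≢j ∘ Finₚ.↑ˡ-injective 1 _ _

    module _ {k′ l′ : Fin n} (k′≢l′ : k′ ≢ l′)
             (const : ∀ p r → p ≢ k′ ↑ˡ 1 × p ≢ l′ ↑ˡ 1 → r ≢ k′ ↑ˡ 1 × r ≢ l′ ↑ˡ 1 → d p ≈ d r) where
      initial-initial : Combination (k′ ↑ˡ 1) (l′ ↑ˡ 1)
      initial-initial = dₖ , dₗ , λ i → R.trans (values i)
        (R.sym (R.+-cong (R.*-congˡ (direction-initial k′ i)) (R.*-congˡ (direction-initial l′ i))))
        where
        dₖ = d (k′ ↑ˡ 1)
        dₗ = d (l′ ↑ˡ 1)
        values : ∀ i → d (i ↑ˡ 1) ≈ dₖ * basis k′ i + dₗ * basis l′ i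
        values i with k′ Finₚ.≟ i | l′ Finₚ.≟ i
        ... | yes refl | yes refl = contradiction refl k′≢l′
        ... | yes refl | no _     = R.sym
          (R.trans (R.+-cong (R.*-identityʳ dₖ) (R.zeroʳ dₗ)) (R.+-identityʳ dₖ))
        ... | no _     | yes refl = R.sym
          (R.trans (R.+-cong (R.zeroʳ dₖ) (R.*-identityʳ dₗ)) (R.+-identityˡ dₗ))
        ... | no k′≢i  | no l′≢i  = R.trans
          (const (i ↑ˡ 1) (n ↑ʳ zero) (↑ˡ-≢ (k′≢i ∘ sym) , ↑ˡ-≢ (l′≢i ∘ sym))
                                      (last≢initial k′ , last≢initial l′))
          (R.trans d-last
            (R.sym (R.trans (R.+-cong (R.zeroʳ dₖ) (R.zeroʳ dₗ)) (R.+-identityˡ 0#))))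

    module _ {l′ : Fin n}
             (const : ∀ p r → p ≢ n ↑ʳ zero × p ≢ l′ ↑ˡ 1 → r ≢ n ↑ʳ zero × r ≢ l′ ↑ˡ 1 → d p ≈ d r) where
      last-initial : Combination (n ↑ʳ zero) (l′ ↑ˡ 1)
      -- The last index belongs to the pair here, so the common value is read at some other index
      -- off the pair.
      last-initial with third 3≤N (n ↑ʳ zero) (l′ ↑ˡ 1)
      ... | p , p∉ = e , dₗ - e , λ i → R.trans (values i)
        (R.sym (R.+-cong (R.trans (R.*-congˡ (direction-last i)) (R.*-identityʳ e))
                         (R.*-congˡ (direction-initial l′ i))))
        where
        e = d p
        dₗ = d (l′ ↑ˡ 1)
        values : ∀ i → d (i ↑ˡ 1) ≈ e + (dₗ - e) * basis l′ i
        values i with l′ Finₚ.≟ i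
        ... | yes refl = begin
          dₗ                    ≈⟨ xyx⁻¹≈y e dₗ ⟨
          e + dₗ - e            ≈⟨ R.+-assoc e dₗ (- e) ⟩
          e + (dₗ - e)          ≈⟨ R.+-congˡ (R.*-identityʳ (dₗ - e)) ⟨
          e + (dₗ - e) * 1#     ∎
        ... | no l′≢i = begin
          d (i ↑ˡ 1)            ≈⟨ const (i ↑ˡ 1) p ((last≢initial i ∘ sym) , ↑ˡ-≢ (l′≢i ∘ sym)) p∉ ⟩
          e                     ≈⟨ R.+-identityʳ e ⟨
          e + 0#                ≈⟨ R.+-congˡ (R.zeroʳ (dₗ - e)) ⟨
          e + (dₗ - e) * 0#     ∎

    go : (∃[ i ] k ≡ i ↑ˡ 1) ⊎ (k ≡ n ↑ʳ zero) →
         (∃[ i ] l ≡ i ↑ˡ 1) ⊎ (l ≡ n ↑ʳ zero) → Combination k l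
    go (inj₁ (k′ , refl)) (inj₁ (l′ , refl)) = initial-initial (λ k′≡l′ → k≢l (cong (_↑ˡ 1) k′≡l′)) const
    go (inj₁ (k′ , refl)) (inj₂ refl) = swap (last-initial
      (λ p r (p≢l , p≢k) (r≢l , r≢k) → const p r (p≢k , p≢l) (r≢k , r≢l)))
    go (inj₂ refl) (inj₁ (l′ , refl)) = last-initial const
    go (inj₂ refl) (inj₂ refl) = contradiction refl k≢l

-- Finite sums

open import Data.Integer.Base using (_+_; _*_; _-_; -_)
open import Algebra.Properties.Semiring.Sum ℤₚ.+-*-semiring
  using (sum; sum-syntax; sum-cong-≗; ∑-distrib-+; ∑-comm; sum-permute;
         *-distribˡ-sum; *-distribʳ-sum)

ind : ∀ {m} → Fin m → Fin m → ℤ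
ind i j = if does (i Finₚ.≟ j) then 1ℤ else 0ℤ

ind-refl : ∀ {m} (i : Fin m) → ind i i ≡ 1ℤ
ind-refl i rewrite dec-true (i Finₚ.≟ i) refl = refl

ind-cong : ∀ {m n} {i j : Fin m} {k l : Fin n} →
           (i ≡ j → k ≡ l) → (k ≡ l → i ≡ j) → ind i j ≡ ind k l
ind-cong {i = i} {j} {k} {l} f g with i Finₚ.≟ j | k Finₚ.≟ l
... | yes _  | yes _  = refl
... | yes p  | no ¬q  = contradiction (f p) ¬q
... | no ¬p  | yes q  = contradiction (g q) ¬p
... | no _   | no _   = refl

ind-nonneg : ∀ {m} (i j : Fin m) → 0ℤ ℤ.≤ ind i j
ind-nonneg i j with does (i Finₚ.≟ j)
... | true  = +≤+ z≤n
... | false = +≤+ z≤n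

ind-idem : ∀ {m} (i j : Fin m) → ind i j * ind i j ≡ ind i j
ind-idem i j with does (i Finₚ.≟ j)
... | true  = refl
... | false = refl

sum-const : ∀ m x → ∑[ i < m ] x ≡ + m * x
sum-const ℕ.zero    x = sym (ℤₚ.*-zeroˡ x)
sum-const (ℕ.suc m) x = trans (cong₂ _+_ {x = x} refl (sum-const m x)) (sym (ℤₚ.suc-* (+ m) x))

sum-0 : ∀ m → ∑[ i < m ] 0ℤ ≡ 0ℤ
sum-0 m = trans (sum-const m 0ℤ) (ℤₚ.*-zeroʳ (+ m))

sum-*1 : ∀ {m} (g : Fin m → ℤ) → ∑[ i < m ] (g i * 1ℤ) ≡ sum g
sum-*1 g = sum-cong-≗ λ i → ℤₚ.*-identityʳ (g i)

sum-ind : ∀ {m} (g : Fin m → ℤ) j → ∑[ i < m ] (ind i j * g i) ≡ g j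
sum-ind {ℕ.suc m} g zero = trans
  (cong₂ _+_ (ℤₚ.*-identityˡ (g zero))
    (trans (sum-cong-≗ λ i → ℤₚ.*-zeroˡ (g (suc i))) (sum-0 m)))
  (ℤₚ.+-identityʳ (g zero))
sum-ind {ℕ.suc m} g (suc j) = trans
  (cong₂ _+_ (ℤₚ.*-zeroˡ (g zero)) (sum-ind (g ∘ suc) j))
  (ℤₚ.+-identityˡ (g (suc j)))

sum-nonneg : ∀ {m} (g : Fin m → ℤ) → (∀ i → 0ℤ ℤ.≤ g i) → 0ℤ ℤ.≤ sum g
sum-nonneg {ℕ.zero}  g 0≤g = ℤₚ.≤-refl
sum-nonneg {ℕ.suc m} g 0≤g = ℤₚ.+-mono-≤ (0≤g zero) (sum-nonneg (g ∘ suc) (0≤g ∘ suc))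

term≤sum : ∀ {m} (g : Fin m → ℤ) → (∀ i → 0ℤ ℤ.≤ g i) → ∀ i → g i ℤ.≤ sum g
term≤sum {ℕ.suc m} g 0≤g zero = ℤₚ.≤-trans
  (ℤₚ.≤-reflexive (sym (ℤₚ.+-identityʳ (g zero))))
  (ℤₚ.+-monoʳ-≤ (g zero) (sum-nonneg (g ∘ suc) (0≤g ∘ suc)))
term≤sum {ℕ.suc m} g 0≤g (suc i) = ℤₚ.≤-trans
  (ℤₚ.≤-reflexive (sym (ℤₚ.+-identityˡ (g (suc i)))))
  (ℤₚ.+-mono-≤ (0≤g zero) (term≤sum (g ∘ suc) (0≤g ∘ suc) i))

0≤square : ∀ x → 0ℤ ℤ.≤ x * x
0≤square (+ n)    = ℤₚ.≤-trans (+≤+ z≤n) (ℤₚ.≤-reflexive (ℤₚ.pos-* n n))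
0≤square -[1+ n ] = +≤+ z≤n

-- The product is negative only strictly between 0 and 1, where there are no integers. This makes
-- the weight `W` nonnegative although it is not a square.
0≤consecutive : ∀ x → 0ℤ ℤ.≤ x * (x - 1ℤ)
0≤consecutive (+ ℕ.zero)  = ℤₚ.≤-refl
0≤consecutive (+ ℕ.suc n) = ℤₚ.≤-trans (+≤+ z≤n) (ℤₚ.≤-reflexive (ℤₚ.pos-* (ℕ.suc n) n))
0≤consecutive -[1+ n ]    = +≤+ z≤n

0≤* : ∀ {x y} → 0ℤ ℤ.≤ x → 0ℤ ℤ.≤ y → 0ℤ ℤ.≤ x * y
0≤* {+ m} {+ n} _ _ = ℤₚ.≤-trans (+≤+ z≤n) (ℤₚ.≤-reflexive (ℤₚ.pos-* m n))

sum-square : ∀ {m} (g : Fin m → ℤ) → sum g * sum g ≡ ∑[ i < m ] ∑[ j < m ] (g i * g j)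
sum-square g = trans (*-distribʳ-sum (sum g) g) (sum-cong-≗ λ i → *-distribˡ-sum (g i) g)

-- Sums over a finite setoid

module FiniteSum {a ℓ} (S : Setoid a ℓ) {m} (card : HasCardinality S m) where
  open Setoid S using (Carrier; _≈_)
    renaming (refl to ≈-refl; sym to ≈-sym; trans to ≈-trans)
  open Inverse card

  ∑ : (Carrier → ℤ) → ℤ
  ∑ h = ∑[ i < m ] h (from i)

  to-from : ∀ i → to (from i) ≡ i
  to-from i = inverseˡ ≈-refl

  from-to : ∀ x → from (to x) ≈ x
  from-to x = inverseʳ refl

  to-injective : ∀ {x y} → to x ≡ to y → x ≈ y
  to-injective {x} {y} eq =
    ≈-trans (≈-sym (from-to x)) (≈-trans (from-cong eq) (from-to y))

  𝟙 : Carrier → Carrier → ℤ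
  𝟙 x y = ind (to x) (to y)

  𝟙-refl : ∀ {x y} → x ≈ y → 𝟙 x y ≡ 1ℤ
  𝟙-refl {x} {y} x≈y = trans (cong (λ k → ind k (to y)) (to-cong x≈y)) (ind-refl (to y))

  𝟙-⇔ : ∀ {x y z w} → (x ≈ y → z ≈ w) → (z ≈ w → x ≈ y) → 𝟙 x y ≡ 𝟙 z w
  𝟙-⇔ f g = ind-cong (to-cong ∘ f ∘ to-injective) (to-cong ∘ g ∘ to-injective)

  𝟙-cong : ∀ {x y z w} → x ≈ z → y ≈ w → 𝟙 x y ≡ 𝟙 z w
  𝟙-cong p q = cong₂ ind (to-cong p) (to-cong q)

  -- A sum sees only the representatives `from i`, and `from (to x)` is merely equivalent to `x`;
  -- this congruence allows passing from one to the other.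
  Respects : (Carrier → ℤ) → Set _
  Respects h = ∀ {x y} → x ≈ y → h x ≡ h y

  ∑-𝟙 : ∀ {g} → Respects g → ∀ y → ∑ (λ x → 𝟙 x y * g x) ≡ g y
  ∑-𝟙 {g} g-resp y = begin
    ∑[ i < m ] (ind (to (from i)) (to y) * g (from i))
      ≡⟨ sum-cong-≗ (λ i → cong (λ k → ind k (to y) * g (from i)) (to-from i)) ⟩
    ∑[ i < m ] (ind i (to y) * g (from i))
      ≡⟨ sum-ind (g ∘ from) (to y) ⟩
    g (from (to y))
      ≡⟨ g-resp (from-to y) ⟩
    g y ∎
    where open ≡-Reasoning

  -- Conjugated by the enumeration, `τ` becomes a permutation of `Fin m`.
  ∑-reindex : ∀ {τ τ⁻¹ : Carrier → Carrier} →
              (∀ {x y} → x ≈ y → τ x ≈ τ y) → (∀ {x y} → x ≈ y → τ⁻¹ x ≈ τ⁻¹ y) →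
              (∀ x → τ (τ⁻¹ x) ≈ x) → (∀ x → τ⁻¹ (τ x) ≈ x) →
              ∀ {h} → Respects h → ∑ (h ∘ τ) ≡ ∑ h
  ∑-reindex {τ} {τ⁻¹} τ-cong τ⁻¹-cong ττ⁻¹ τ⁻¹τ {h} h-resp = begin
    ∑[ i < m ] h (τ (from i))
      ≡⟨ sum-cong-≗ (λ i → h-resp (≈-sym (from-to (τ (from i))))) ⟩
    ∑[ i < m ] h (from (to (τ (from i))))
      ≡⟨ sum-permute (h ∘ from) π ⟨
    ∑[ i < m ] h (from i) ∎
    where
    open ≡-Reasoning
    π : Perm.Permutation m m
    π = Perm.permutation (λ i → to (τ (from i))) (λ i → to (τ⁻¹ (from i)))
      (λ i → trans (to-cong (≈-trans (τ-cong (from-to _)) (ττ⁻¹ _))) (to-from i))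
      (λ i → trans (to-cong (≈-trans (τ⁻¹-cong (from-to _)) (τ⁻¹τ _))) (to-from i))

  term≤∑ : ∀ {h} → Respects h → (∀ x → 0ℤ ℤ.≤ h x) → ∀ x → h x ℤ.≤ ∑ h
  term≤∑ {h} h-resp 0≤h x = ℤₚ.≤-trans
    (ℤₚ.≤-reflexive (h-resp (≈-sym (from-to x))))
    (term≤sum (h ∘ from) (λ i → 0≤h (from i)) (to x))

funToFin-cong : ∀ {m n} {f g : Fin m → Fin n} → f ≗ g → Fin.funToFin f ≡ Fin.funToFin g
funToFin-cong {ℕ.zero}  f≗g = refl
funToFin-cong {ℕ.suc m} f≗g = cong₂ combine (f≗g zero) (funToFin-cong (f≗g ∘ suc))

module _ {a ℓ} (S : Setoid a ℓ) {q} (card : HasCardinality S q) where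
  open Setoid S using () renaming (trans to ≈-trans)
  open VectorEquality S using (≋-setoid)
  open Inverse card
  open FiniteSum S card using (to-from; from-to)

  vectors-cardinality : ∀ N → HasCardinality (≋-setoid N) (q ℕ.^ N)
  vectors-cardinality N = record
    { to        = λ v → Fin.funToFin (to ∘ v)
    ; from      = λ k → from ∘ Fin.finToFun k
    ; to-cong   = λ v≋w → funToFin-cong (to-cong ∘ v≋w)
    ; from-cong = λ { refl _ → from-cong refl }
    ; inverse   =
        (λ {k} v≋ → trans (funToFin-cong λ i → trans (to-cong (v≋ i)) (to-from _))
                          (Finₚ.funToFin-finToFin {N} {q} k))
      , (λ {v} k≡ i → ≈-trans
          (from-cong (trans (cong (λ k → Fin.finToFun {q} {N} k i) k≡)
                            (Finₚ.finToFun-funToFin (to ∘ v) i)))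
          (from-to (v i)))
    }

-- Counting over vectors of length N with coordinate sum zero

module Linear {c ℓ} (R : CommutativeRing c ℓ) where
  private
    module R = CommutativeRing R
    open AbelianGroupProperties R.+-abelianGroup using (⁻¹-∙-comm; inverseʳ-unique; x∙y⁻¹≈ε⇒x≈y; x≈y⇒x∙y⁻¹≈ε)
    open CommutativeSemigroupProperties R.+-commutativeSemigroup using (interchange; xy∙z≈xz∙y)
    open RingProperties R.ring using (-‿distribˡ-*; -‿distribʳ-*)

  open R using (Carrier; _≈_; 0#; 1#)
  open VectorEquality R.setoid using (_≋_)

  dot : ∀ {N} → Vector Carrier N → Vector Carrier N → Carrier
  dot {ℕ.zero}  x a = 0#
  dot {ℕ.suc N} x a = a zero R.* x zero R.+ dot (x ∘ suc) (a ∘ suc)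

  bump : ∀ {N} → Fin N → Carrier → Vector Carrier N → Vector Carrier N
  bump k t a = updateAt a k (R._+ t)

  dot-cong : ∀ {N} (x : Vector Carrier N) {a b} → a ≋ b → dot x a ≈ dot x b
  dot-cong {ℕ.zero}  x a≋b = R.refl
  dot-cong {ℕ.suc N} x a≋b =
    R.+-cong (R.*-congʳ (a≋b zero)) (dot-cong (x ∘ suc) (a≋b ∘ suc))

  dot-0ᵛ : ∀ {N} (x : Vector Carrier N) → dot x (λ _ → 0#) ≈ 0#
  dot-0ᵛ {ℕ.zero}  x = R.refl
  dot-0ᵛ {ℕ.suc N} x =
    R.trans (R.+-cong (R.zeroˡ (x zero)) (dot-0ᵛ (x ∘ suc))) (R.+-identityˡ 0#)

  dot-sub : ∀ {N} (x y a : Vector Carrier N) →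
          dot (λ i → x i R.- y i) a ≈ dot x a R.- dot y a
  dot-sub {ℕ.zero}  x y a = R.sym (R.-‿inverseʳ 0#)
  dot-sub {ℕ.suc N} x y a = begin
    a₀ R.* (x₀ R.- y₀) R.+ dot (λ i → x (suc i) R.- y (suc i)) (a ∘ suc)
      ≈⟨ R.+-cong (R.distribˡ a₀ x₀ (R.- y₀)) (dot-sub (x ∘ suc) (y ∘ suc) (a ∘ suc)) ⟩
    (a₀ R.* x₀ R.+ a₀ R.* R.- y₀) R.+ (X R.- Y)
      ≈⟨ R.+-congʳ (R.+-congˡ (-‿distribʳ-* a₀ y₀)) ⟨
    (a₀ R.* x₀ R.- a₀ R.* y₀) R.+ (X R.- Y)
      ≈⟨ interchange (a₀ R.* x₀) (R.- (a₀ R.* y₀)) X (R.- Y) ⟩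
    (a₀ R.* x₀ R.+ X) R.+ (R.- (a₀ R.* y₀) R.- Y)
      ≈⟨ R.+-congˡ (⁻¹-∙-comm (a₀ R.* y₀) Y) ⟩
    (a₀ R.* x₀ R.+ X) R.- (a₀ R.* y₀ R.+ Y) ∎
    where
    open SetoidReasoning R.setoid
    a₀ = a zero
    x₀ = x zero
    y₀ = y zero
    X = dot (x ∘ suc) (a ∘ suc)
    Y = dot (y ∘ suc) (a ∘ suc)

  dot-bump : ∀ {N} (x a : Vector Carrier N) k t →
             dot x (bump k t a) ≈ dot x a R.+ t R.* x k
  dot-bump {ℕ.suc N} x a zero t = R.trans
    (R.+-congʳ (R.distribʳ (x zero) (a zero) t))
    (xy∙z≈xz∙y (a zero R.* x zero) (t R.* x zero) (dot (x ∘ suc) (a ∘ suc)))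
  dot-bump {ℕ.suc N} x a (suc k) t = R.trans
    (R.+-congˡ (dot-bump (x ∘ suc) (a ∘ suc) k t))
    (R.sym (R.+-assoc _ _ _))

  bump-cong : ∀ {N} (k : Fin N) t {a b} → a ≋ b → bump k t a ≋ bump k t b
  bump-cong zero    t a≋b zero    = R.+-congʳ (a≋b zero)
  bump-cong zero    t a≋b (suc i) = a≋b (suc i)
  bump-cong (suc k) t a≋b zero    = a≋b zero
  bump-cong (suc k) t a≋b (suc i) = bump-cong k t (a≋b ∘ suc) i

  bump-inverse : ∀ {N} (k : Fin N) {s t} → s R.+ t ≈ 0# → ∀ a → bump k t (bump k s a) ≋ a
  bump-inverse zero    s+t≈0 a zero    =
    R.trans (R.+-assoc (a zero) _ _) (R.trans (R.+-congˡ s+t≈0) (R.+-identityʳ (a zero)))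
  bump-inverse zero    s+t≈0 a (suc i) = R.refl
  bump-inverse (suc k) s+t≈0 a zero    = R.refl
  bump-inverse (suc k) s+t≈0 a (suc i) = bump-inverse k s+t≈0 (a ∘ suc) i

  bump-at : ∀ {N} (k : Fin N) t a → bump k t a k ≡ a k R.+ t
  bump-at k t a = Vecₚ.updateAt-updates k a

  bump-off : ∀ {N} {i k : Fin N} → i ≢ k → ∀ t a → bump k t a i ≡ a i
  bump-off {i = i} {k} i≢k t a = Vecₚ.updateAt-minimal i k a i≢k

  -- This adds `t` times e_p - e_r, a vector of coordinate sum 0.
  shift : ∀ {N} → Fin N → Fin N → Carrier → Vector Carrier N → Vector Carrier N
  shift p r t a = bump r (R.- t) (bump p t a)

  dot-shift : ∀ {N} (x a : Vector Carrier N) p r t →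
              dot x (shift p r t a) ≈ dot x a R.+ t R.* (x p R.- x r)
  dot-shift x a p r t = begin
    dot x (shift p r t a)
      ≈⟨ dot-bump x (bump p t a) r (R.- t) ⟩
    dot x (bump p t a) R.+ R.- t R.* x r
      ≈⟨ R.+-congʳ (dot-bump x a p t) ⟩
    (dot x a R.+ t R.* x p) R.+ R.- t R.* x r
      ≈⟨ R.+-assoc _ _ _ ⟩
    dot x a R.+ (t R.* x p R.+ R.- t R.* x r)
      ≈⟨ R.+-congˡ (R.+-congˡ (R.trans (R.sym (-‿distribˡ-* t (x r))) (-‿distribʳ-* t (x r)))) ⟩
    dot x a R.+ (t R.* x p R.+ t R.* R.- x r)
      ≈⟨ R.+-congˡ (R.distribˡ t (x p) (R.- x r)) ⟨
    dot x a R.+ t R.* (x p R.- x r) ∎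
    where open SetoidReasoning R.setoid

  module Counting {q} (card : HasCardinality R.setoid q) (N : ℕ) where
    open VectorEquality R.setoid using (≋-setoid)
    module ∑V = FiniteSum (≋-setoid N) (vectors-cardinality R.setoid card N)
    private
      module ∑F = FiniteSum R.setoid card
      module F = Inverse card
      module VV = Inverse (vectors-cardinality R.setoid card N)
    open ∑F using (𝟙) public
    V = Vector Carrier N

    ∑-bump : ∀ k t {h} → ∑V.Respects h → ∑V.∑ (h ∘ bump k t) ≡ ∑V.∑ h
    ∑-bump k t = ∑V.∑-reindex (bump-cong k t) (bump-cong k (R.- t))
      (bump-inverse k (R.-‿inverseˡ t)) (bump-inverse k (R.-‿inverseʳ t))

    ∑-shift : ∀ p r t {h} → ∑V.Respects h → ∑V.∑ (h ∘ shift p r t) ≡ ∑V.∑ h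
    ∑-shift p r t h-resp = trans
      (∑-bump p t (λ x≋y → h-resp (bump-cong r (R.- t) x≋y)))
      (∑-bump r (R.- t) h-resp)

    -- The weight `h` is invariant under every `τ s`, while `φ` is translated by `s`. Hence `φ` is
    -- uniformly distributed with respect to `h`, and its zero set carries the fraction 1/q of the
    -- total. Concretely, `τ s` is applied to the copy indexed by `s` among q copies of the sum.
    equidistribution : ∀ {h : V → ℤ} {φ : V → Carrier} →
      ∑V.Respects h → (∀ {a b} → a ≋ b → φ a ≈ φ b) →
      (τ : Carrier → V → V) → (∀ s {g} → ∑V.Respects g → ∑V.∑ (g ∘ τ s) ≡ ∑V.∑ g) →
      (∀ s a → h (τ s a) ≡ h a) → (∀ s a → φ (τ s a) ≈ φ a R.+ s) →
      + q * ∑V.∑ (λ a → h a * 𝟙 (φ a) 0#) ≡ ∑V.∑ h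
    equidistribution {h} {φ} h-resp φ-cong τ ∑-τ h-τ φ-τ = begin
      + q * ∑V.∑ (λ a → h a * 𝟙 (φ a) 0#)
        ≡⟨ sum-const q _ ⟨
      ∑F.∑ (λ _ → ∑V.∑ (λ a → h a * 𝟙 (φ a) 0#))
        ≡⟨ sum-cong-≗ (λ i → ∑-τ (F.from i)
             (λ a≋b → cong₂ _*_ (h-resp a≋b) (∑F.𝟙-cong (φ-cong a≋b) R.refl))) ⟨
      ∑F.∑ (λ s → ∑V.∑ (λ a → h (τ s a) * 𝟙 (φ (τ s a)) 0#))
        ≡⟨ sum-cong-≗ (λ i → sum-cong-≗ λ j →
             cong₂ _*_ (h-τ (F.from i) (VV.from j)) (translate (F.from i) (VV.from j))) ⟩
      -- For each `a` exactly one `s`, the negative of `φ a`, makes `φ a + s` vanish. The factor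
      -- `1ℤ` fits the shape of `∑-𝟙`.
      ∑F.∑ (λ s → ∑V.∑ (λ a → h a * (𝟙 s (R.- φ a) * 1ℤ)))
        ≡⟨ ∑-comm (λ i j → h (VV.from j) * (𝟙 (F.from i) (R.- φ (VV.from j)) * 1ℤ)) ⟩
      ∑V.∑ (λ a → ∑F.∑ (λ s → h a * (𝟙 s (R.- φ a) * 1ℤ)))
        ≡⟨ sum-cong-≗ (λ j → sym (*-distribˡ-sum (h (VV.from j))
             (λ i → 𝟙 (F.from i) (R.- φ (VV.from j)) * 1ℤ))) ⟩
      ∑V.∑ (λ a → h a * ∑F.∑ (λ s → 𝟙 s (R.- φ a) * 1ℤ))
        ≡⟨ sum-cong-≗ (λ j → trans
             (cong (h (VV.from j) *_) (∑F.∑-𝟙 {λ _ → 1ℤ} (λ _ → refl) (R.- φ (VV.from j))))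
             (ℤₚ.*-identityʳ _)) ⟩
      ∑V.∑ h ∎
      where
      open ≡-Reasoning
      translate : ∀ s a → 𝟙 (φ (τ s a)) 0# ≡ 𝟙 s (R.- φ a) * 1ℤ
      translate s a = trans
        (∑F.𝟙-⇔ (λ e → inverseʳ-unique (φ a) s (R.trans (R.sym (φ-τ s a)) e))
                (λ e → R.trans (φ-τ s a) (R.trans (R.+-congˡ e) (R.-‿inverseʳ (φ a)))))
        (sym (ℤₚ.*-identityʳ _))

    σ : V → Carrier
    σ = dot (λ _ → 1#)

    -- Sums over the hyperplane of coordinate sum 0 are taken over all of `V` with this factor. The
    -- hyperplane is the annihilator of the all-ones vector, modulo which extended vectors are
    -- considered.
    s₀ : V → ℤ
    s₀ a = 𝟙 (σ a) 0#

    z : Fin N → V → ℤ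
    z k a = 𝟙 (a k) 0#

    s₀-resp : ∑V.Respects s₀
    s₀-resp a≋b = ∑F.𝟙-cong (dot-cong _ a≋b) R.refl

    z-resp : ∀ k → ∑V.Respects (z k)
    z-resp k a≋b = ∑F.𝟙-cong (a≋b k) R.refl

    s₀-shift : ∀ p r t a → s₀ (shift p r t a) ≡ s₀ a
    s₀-shift p r t a = ∑F.𝟙-cong
      (R.trans (dot-shift (λ _ → 1#) a p r t)
        (R.trans (R.+-congˡ (R.trans (R.*-congˡ (R.-‿inverseʳ 1#)) (R.zeroʳ t)))
          (R.+-identityʳ (σ a))))
      R.refl

    FixedBy : Fin N → (V → ℤ) → Set _
    FixedBy p g = ∀ t a → g (bump p t a) ≡ g a

    z-fixed : ∀ {p k} → p ≢ k → FixedBy p (z k)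
    z-fixed p≢k t a = ∑F.𝟙-cong (R.reflexive (bump-off (p≢k ∘ sym) t a)) R.refl

    s₀*-shift : ∀ {g p r} → FixedBy p g → FixedBy r g →
                ∀ t a → s₀ (shift p r t a) * g (shift p r t a) ≡ s₀ a * g a
    s₀*-shift {g} {p} {r} g-p g-r t a =
      cong₂ _*_ (s₀-shift p r t a) (trans (g-r (R.- t) (bump p t a)) (g-p t a))

    s₀*-resp : ∀ {g} → ∑V.Respects g → ∑V.Respects (λ a → s₀ a * g a)
    s₀*-resp g-resp a≋b = cong₂ _*_ (s₀-resp a≋b) (g-resp a≋b)

    -- Shifting by `s * e` along e_p - e_r changes the product with `d` by `s * e * (d p - d r)`,
    -- which is `s`, and leaves `s₀` and `g` unchanged.
    ∑-dot : ∀ {g p r d e} → ∑V.Respects g → FixedBy p g → FixedBy r g →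
            e R.* (d p R.- d r) ≈ 1# →
            + q * ∑V.∑ (λ a → s₀ a * g a * 𝟙 (dot d a) 0#) ≡ ∑V.∑ (λ a → s₀ a * g a)
    ∑-dot {g} {p} {r} {d} {e} g-resp g-p g-r e-inverse = equidistribution
      (s₀*-resp g-resp) (dot-cong d) (λ s → shift p r (s R.* e)) (λ s → ∑-shift p r (s R.* e))
      (λ s → s₀*-shift g-p g-r (s R.* e))
      (λ s a → R.trans (dot-shift d a p r (s R.* e))
        (R.+-congˡ (R.trans (R.*-assoc s e _)
          (R.trans (R.*-congˡ e-inverse) (R.*-identityʳ s)))))

    -- The shift moves coordinate `k` by `s`, and coordinate `r` takes the compensating change, to
    -- which `g` is blind.
    ∑-z : ∀ {g k r} → ∑V.Respects g → FixedBy k g → FixedBy r g → k ≢ r →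
          + q * ∑V.∑ (λ a → s₀ a * g a * z k a) ≡ ∑V.∑ (λ a → s₀ a * g a)
    ∑-z {g} {k} {r} g-resp g-k g-r k≢r = equidistribution
      (s₀*-resp g-resp) (λ a≋b → a≋b k) (shift k r) (λ s → ∑-shift k r s)
      (s₀*-shift g-k g-r)
      (λ s a → R.reflexive (trans (bump-off k≢r (R.- s) (bump k s a)) (bump-at k s a)))

    -- Here the coordinate sum itself has to move, so a single `bump` without compensation is
    -- applied.
    ∑-s₀ : Fin N → + q * ∑V.∑ s₀ ≡ + (q ℕ.^ N)
    ∑-s₀ k = trans
      (trans (cong (+ q *_) (sum-cong-≗ λ j → sym (ℤₚ.*-identityˡ (s₀ (VV.from j)))))
        (equidistribution {h = λ _ → 1ℤ} (λ _ → refl) (dot-cong _) (bump k) (∑-bump k)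
          (λ _ _ → refl)
          (λ s a → R.trans (dot-bump (λ _ → 1#) a k s) (R.+-congˡ (R.*-identityʳ s)))))
      (trans (sum-const (q ℕ.^ N) 1ℤ) (ℤₚ.*-identityʳ _))

    Z : V → ℤ
    Z a = ∑[ k < N ] z k a

    Z-resp : ∑V.Respects Z
    Z-resp a≋b = sum-cong-≗ λ k → z-resp k a≋b

    -- The quadratic weight and the moments of the number of zeros

    module Weight (f : ℤ) where
      P : ℤ → ℤ
      P y = (y - f) * (y - f - 1ℤ)

      W : V → ℤ
      W a = s₀ a * P (Z a)

      W-resp : ∑V.Respects W
      W-resp = s₀*-resp (λ a≋b → cong P (Z-resp a≋b))

      0≤W : ∀ a → 0ℤ ℤ.≤ W a
      0≤W a = 0≤* (ind-nonneg (F.to (σ a)) (F.to 0#)) (0≤consecutive (Z a - f))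

      -- Since `P` is quadratic, expanding the powers of `Z` leaves terms that involve at most two
      -- coordinates besides `ψ`. The test function is arbitrary because both the constant 1 and the
      -- kernel of a pair are inserted. The factor `1ℤ` gives the last term the form
      -- `s₀ a * g a * ψ a` of the others.
      ∑-W : ∀ (ψ : V → ℤ) → ∑V.∑ (λ a → W a * ψ a) ≡
              ∑[ k < N ] ∑[ l < N ] ∑V.∑ (λ a → s₀ a * (z k a * z l a) * ψ a)
            + - (f + f + 1ℤ) * ∑[ k < N ] ∑V.∑ (λ a → s₀ a * z k a * ψ a)
            + f * (f + 1ℤ) * ∑V.∑ (λ a → s₀ a * 1ℤ * ψ a)
      ∑-W ψ = begin
        ∑V.∑ (λ a → W a * ψ a)
          ≡⟨ sum-cong-≗ (λ j → pointwise (VV.from j)) ⟩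
        ∑V.∑ (λ a → T₂ a + c₁ * T₁ a + c₀ * T₀ a)
          ≡⟨ ∑-distrib-+ (λ j → T₂ (VV.from j) + c₁ * T₁ (VV.from j)) (λ j → c₀ * T₀ (VV.from j)) ⟩
        ∑V.∑ (λ a → T₂ a + c₁ * T₁ a) + ∑V.∑ (λ a → c₀ * T₀ a)
          ≡⟨ cong₂ _+_ (∑-distrib-+ (T₂ ∘ VV.from) (λ j → c₁ * T₁ (VV.from j)))
                       (sym (*-distribˡ-sum c₀ (T₀ ∘ VV.from))) ⟩
        ∑V.∑ T₂ + ∑V.∑ (λ a → c₁ * T₁ a) + c₀ * ∑V.∑ T₀
          ≡⟨ cong (λ y → ∑V.∑ T₂ + y + c₀ * ∑V.∑ T₀) (sym (*-distribˡ-sum c₁ (T₁ ∘ VV.from))) ⟩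
        ∑V.∑ T₂ + c₁ * ∑V.∑ T₁ + c₀ * ∑V.∑ T₀
          ≡⟨ cong₂ (λ x y → x + c₁ * y + c₀ * ∑V.∑ T₀)
               (trans (∑-comm (λ j k → ∑[ l < N ] t₂ k l (VV.from j)))
                 (sum-cong-≗ λ k → ∑-comm (λ j l → t₂ k l (VV.from j))))
               (∑-comm (λ j k → t₁ k (VV.from j))) ⟩
        ∑[ k < N ] ∑[ l < N ] ∑V.∑ (t₂ k l) + c₁ * ∑[ k < N ] ∑V.∑ (t₁ k) + c₀ * ∑V.∑ T₀ ∎
        where
        open ≡-Reasoning
        c₁ = - (f + f + 1ℤ)
        c₀ = f * (f + 1ℤ)
        t₂ : Fin N → Fin N → V → ℤ
        t₂ k l a = s₀ a * (z k a * z l a) * ψ a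
        t₁ : Fin N → V → ℤ
        t₁ k a = s₀ a * z k a * ψ a
        T₂ T₁ T₀ : V → ℤ
        T₂ a = ∑[ k < N ] ∑[ l < N ] t₂ k l a
        T₁ a = ∑[ k < N ] t₁ k a
        T₀ a = s₀ a * 1ℤ * ψ a

        distrib : ∀ {n} x (g : Fin n → ℤ) y → ∑[ i < n ] (x * g i * y) ≡ x * sum g * y
        distrib x g y = sym (trans (cong (_* y) (*-distribˡ-sum x g)) (*-distribʳ-sum y (λ i → x * g i)))

        expand : ∀ s y w → s * P y * w ≡
                 s * (y * y) * w + - (f + f + 1ℤ) * (s * y * w) + f * (f + 1ℤ) * (s * 1ℤ * w)
        expand = expand′ f
          where
          expand′ : ∀ f s y w → s * ((y - f) * (y - f - 1ℤ)) * w ≡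
                    s * (y * y) * w + - (f + f + 1ℤ) * (s * y * w) + f * (f + 1ℤ) * (s * 1ℤ * w)
          expand′ = solve-∀

        pointwise : ∀ a → W a * ψ a ≡ T₂ a + c₁ * T₁ a + c₀ * T₀ a
        pointwise a = trans (expand (s₀ a) (Z a) (ψ a))
          (cong₂ (λ x y → x + c₁ * y + c₀ * T₀ a)
            (sym (trans (sum-cong-≗ λ k → distrib (s₀ a) (λ l → z k a * z l a) (ψ a))
              (trans (distrib (s₀ a) (λ k → ∑[ l < N ] (z k a * z l a)) (ψ a))
                (cong (λ y → s₀ a * y * ψ a) (sym (sum-square (λ k → z k a)))))))
            (sym (distrib (s₀ a) (λ k → z k a) (ψ a))))

    Z-0ᵛ : Z (λ _ → 0#) ≡ + N
    Z-0ᵛ = trans (sum-cong-≗ {N} λ _ → ∑F.𝟙-refl {0#} {0#} R.refl) (trans (sum-const N 1ℤ) (ℤₚ.*-identityʳ (+ N)))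

    -- `X` stands for q^(N - 3), specified by a product so that no subtraction of exponents occurs.
    module Moments (third : ∀ (k l : Fin N) → ∃[ p ] p ≢ k × p ≢ l)
                   .{{_ : ℕ.NonZero q}}
                   (X : ℤ) (q^N≡q³X : + (q ℕ.^ N) ≡ + q * (+ q * (+ q * X))) where

      cancel-q : ∀ {x y} → + q * x ≡ + q * y → x ≡ y
      cancel-q {x} {y} = ℤₚ.*-cancelˡ-≡ (+ q) x y

      ∑-s₀≡ : Fin N → ∑V.∑ s₀ ≡ + q * (+ q * X)
      ∑-s₀≡ k = cancel-q (trans (∑-s₀ k) q^N≡q³X)

      ∑-s₀z≡ : ∀ k → ∑V.∑ (λ a → s₀ a * z k a) ≡ + q * X
      ∑-s₀z≡ k with third k k
      ... | r , r≢k , _ = cancel-q (begin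
        + q * ∑V.∑ (λ a → s₀ a * z k a)
          ≡⟨ cong (+ q *_) (sum-cong-≗ λ j →
               cong (_* z k (VV.from j)) (sym (ℤₚ.*-identityʳ (s₀ (VV.from j))))) ⟩
        + q * ∑V.∑ (λ a → s₀ a * 1ℤ * z k a)
          ≡⟨ ∑-z {λ _ → 1ℤ} (λ _ → refl) (λ _ _ → refl) (λ _ _ → refl) (r≢k ∘ sym) ⟩
        ∑V.∑ (λ a → s₀ a * 1ℤ)
          ≡⟨ sum-*1 (s₀ ∘ VV.from) ⟩
        ∑V.∑ s₀
          ≡⟨ ∑-s₀≡ k ⟩
        + q * (+ q * X) ∎)
        where open ≡-Reasoning

      -- A second zero divides the count by q once more: the shift between `l` and a third
      -- coordinate `r` leaves coordinate `k` alone.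
      ∑-s₀zz≡ : ∀ {k l} → k ≢ l → ∑V.∑ (λ a → s₀ a * (z k a * z l a)) ≡ X
      ∑-s₀zz≡ {k} {l} k≢l with third k l
      ... | r , r≢k , r≢l = cancel-q (begin
        + q * ∑V.∑ (λ a → s₀ a * (z k a * z l a))
          ≡⟨ cong (+ q *_) (sum-cong-≗ λ j → sym (ℤₚ.*-assoc (s₀ (VV.from j)) _ _)) ⟩
        + q * ∑V.∑ (λ a → s₀ a * z k a * z l a)
          ≡⟨ ∑-z (z-resp k) (z-fixed (k≢l ∘ sym)) (z-fixed r≢k) (r≢l ∘ sym) ⟩
        ∑V.∑ (λ a → s₀ a * z k a)
          ≡⟨ ∑-s₀z≡ k ⟩
        + q * X ∎)
        where open ≡-Reasoning

      -- On the diagonal the product of indicators is a single indicator, so the value is `+ q * X`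
      -- instead of `X`. Writing the excess with `ind l k` lets `sum-ind` sum a row over `l`.
      ∑-s₀zz : ∀ k l → ∑V.∑ (λ a → s₀ a * (z k a * z l a) * 1ℤ) ≡ X + ind l k * (+ q * X - X)
      ∑-s₀zz k l with l Finₚ.≟ k
      ... | yes refl = begin
        ∑V.∑ (λ a → s₀ a * (z k a * z k a) * 1ℤ)
          ≡⟨ sum-cong-≗ (λ j → trans (ℤₚ.*-identityʳ _)
               (cong (s₀ (VV.from j) *_) (ind-idem (F.to (VV.from j k)) (F.to 0#)))) ⟩
        ∑V.∑ (λ a → s₀ a * z k a)
          ≡⟨ ∑-s₀z≡ k ⟩
        + q * X
          ≡⟨ rearrange (+ q * X) X ⟩
        X + 1ℤ * (+ q * X - X) ∎
        where
        open ≡-Reasoning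
        rearrange : ∀ x y → x ≡ y + 1ℤ * (x - y)
        rearrange = solve-∀
      ... | no l≢k = begin
        ∑V.∑ (λ a → s₀ a * (z k a * z l a) * 1ℤ)
          ≡⟨ sum-*1 (λ j → s₀ (VV.from j) * (z k (VV.from j) * z l (VV.from j))) ⟩
        ∑V.∑ (λ a → s₀ a * (z k a * z l a))
          ≡⟨ ∑-s₀zz≡ (l≢k ∘ sym) ⟩
        X
          ≡⟨ ℤₚ.+-identityʳ X ⟨
        X + 0ℤ * (+ q * X - X) ∎
        where open ≡-Reasoning

      -- All N² ordered pairs contribute `X`, and the N diagonal ones contribute the excess
      -- `+ q * X - X` in addition. The first argument is a coordinate to move in `∑-s₀`.
      sum-W : Fin N → ∀ f → let open Weight f in
        ∑V.∑ W ≡ + N * (+ N * X + (+ q * X - X))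
                 + - (f + f + 1ℤ) * (+ N * (+ q * X)) + f * (f + 1ℤ) * (+ q * (+ q * X))
      sum-W k₀ f = begin
        ∑V.∑ W
          ≡⟨ sum-*1 (W ∘ VV.from) ⟨
        ∑V.∑ (λ a → W a * 1ℤ)
          ≡⟨ ∑-W (λ _ → 1ℤ) ⟩
        ∑[ k < N ] ∑[ l < N ] ∑V.∑ (λ a → s₀ a * (z k a * z l a) * 1ℤ)
            + - (f + f + 1ℤ) * ∑[ k < N ] ∑V.∑ (λ a → s₀ a * z k a * 1ℤ)
            + f * (f + 1ℤ) * ∑V.∑ (λ a → s₀ a * 1ℤ * 1ℤ)
          ≡⟨ cong₂ _+_ (cong₂ (λ x y → x + - (f + f + 1ℤ) * y) second first)
               (cong (f * (f + 1ℤ) *_) zeroth) ⟩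
        + N * (+ N * X + (+ q * X - X))
            + - (f + f + 1ℤ) * (+ N * (+ q * X)) + f * (f + 1ℤ) * (+ q * (+ q * X)) ∎
        where
        open ≡-Reasoning
        open Weight f
        zeroth : ∑V.∑ (λ a → s₀ a * 1ℤ * 1ℤ) ≡ + q * (+ q * X)
        zeroth = trans (sum-*1 (λ j → s₀ (VV.from j) * 1ℤ))
          (trans (sum-*1 (s₀ ∘ VV.from)) (∑-s₀≡ k₀))
        first : ∑[ k < N ] ∑V.∑ (λ a → s₀ a * z k a * 1ℤ) ≡ + N * (+ q * X)
        first = trans
          (sum-cong-≗ λ k → trans (sum-*1 (λ j → s₀ (VV.from j) * z k (VV.from j))) (∑-s₀z≡ k))
          (sum-const N (+ q * X))
        row : ∀ k → ∑[ l < N ] (X + ind l k * (+ q * X - X)) ≡ + N * X + (+ q * X - X)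
        row k = trans (∑-distrib-+ (λ _ → X) (λ l → ind l k * (+ q * X - X)))
          (cong₂ _+_ (sum-const N X) (sum-ind (λ _ → + q * X - X) k))
        second : ∑[ k < N ] ∑[ l < N ] ∑V.∑ (λ a → s₀ a * (z k a * z l a) * 1ℤ)
                 ≡ + N * (+ N * X + (+ q * X - X))
        second = trans
          (sum-cong-≗ λ k → trans (sum-cong-≗ λ l → ∑-s₀zz k l) (row k))
          (sum-const N _)

    -- Doubly negated because in a Heyting field x ≉ y yields only ¬ ¬ (x # y); this
    -- suffices, as it is used to prove equations in ℤ, which are decidable.
    Spread : V → Set _
    Spread d = ∀ k l → k ≢ l →
      ¬ ¬ (∃[ p ] ∃[ r ] ∃[ e ] (p ≢ k × p ≢ l) × (r ≢ k × r ≢ l) × e R.* (d p R.- d r) ≈ 1#)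

    -- Vanishing of the contribution of a pair

    module Orthogonality (third : ∀ (k l : Fin N) → ∃[ p ] p ≢ k × p ≢ l) {d : V} (spread : Spread d) where

      -- In terms of characters this is the sum of all nontrivial additive characters of the field
      -- at ⟨d, a⟩. It has mean 0 whenever ⟨d, a⟩ is uniformly distributed.
      ψ : V → ℤ
      ψ a = + q * 𝟙 (dot d a) 0# - 1ℤ

      -- `Spread` yields p and r off {k, l} at which `d` differs. Shifting along e_p - e_r preserves
      -- `g` and moves ⟨d, a⟩ through the whole field, so `∑-dot` makes the two parts of `ψ` cancel.
      ∑-s₀ψ≡0 : ∀ {g} k l → k ≢ l → ∑V.Respects g →
                (∀ {p} → p ≢ k → p ≢ l → FixedBy p g) →
                ∑V.∑ (λ a → s₀ a * g a * ψ a) ≡ 0ℤ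
      ∑-s₀ψ≡0 {g} k l k≢l g-resp g-fixed = decidable-stable (_ ℤₚ.≟ 0ℤ) λ ≢0 →
        spread k l k≢l λ (p , r , e , (p≢k , p≢l) , (r≢k , r≢l) , e-inverse) → ≢0 (begin
          ∑V.∑ (λ a → s₀ a * g a * ψ a)
            ≡⟨ sum-cong-≗ (λ j → expand (s₀g (VV.from j)) (+ q) (𝟙 (dot d (VV.from j)) 0#)) ⟩
          ∑V.∑ (λ a → + q * (s₀g a * 𝟙 (dot d a) 0#) + - 1ℤ * s₀g a)
            ≡⟨ ∑-distrib-+ (λ j → + q * (s₀g (VV.from j) * 𝟙 (dot d (VV.from j)) 0#))
                           (λ j → - 1ℤ * s₀g (VV.from j)) ⟩
          ∑V.∑ (λ a → + q * (s₀g a * 𝟙 (dot d a) 0#)) + ∑V.∑ (λ a → - 1ℤ * s₀g a)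
            ≡⟨ cong₂ _+_ (*-distribˡ-sum (+ q) (λ j → s₀g (VV.from j) * 𝟙 (dot d (VV.from j)) 0#))
                         (*-distribˡ-sum (- 1ℤ) (s₀g ∘ VV.from)) ⟨
          + q * ∑V.∑ (λ a → s₀g a * 𝟙 (dot d a) 0#) + - 1ℤ * ∑V.∑ s₀g
            ≡⟨ cong (_+ - 1ℤ * ∑V.∑ s₀g)
                 (∑-dot g-resp (g-fixed p≢k p≢l) (g-fixed r≢k r≢l) e-inverse) ⟩
          ∑V.∑ s₀g + - 1ℤ * ∑V.∑ s₀g
            ≡⟨ collapse (∑V.∑ s₀g) ⟩
          0ℤ ∎)
        where
        open ≡-Reasoning
        s₀g : V → ℤ
        s₀g a = s₀ a * g a
        expand : ∀ x q y → x * (q * y - 1ℤ) ≡ q * (x * y) + - 1ℤ * x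
        expand = solve-∀
        collapse : ∀ x → x + - 1ℤ * x ≡ 0ℤ
        collapse = solve-∀

      ∑-Wψ≡0 : Fin N → ∀ f → ∑V.∑ (λ a → Weight.W f a * ψ a) ≡ 0ℤ
      ∑-Wψ≡0 k₀ f = begin
        ∑V.∑ (λ a → W a * ψ a)
          ≡⟨ ∑-W ψ ⟩
        ∑[ k < N ] ∑[ l < N ] ∑V.∑ (λ a → s₀ a * (z k a * z l a) * ψ a)
            + - (f + f + 1ℤ) * ∑[ k < N ] ∑V.∑ (λ a → s₀ a * z k a * ψ a)
            + f * (f + 1ℤ) * ∑V.∑ (λ a → s₀ a * 1ℤ * ψ a)
          ≡⟨ cong₂ _+_ (cong₂ (λ x y → x + - (f + f + 1ℤ) * y) second first)
               (cong (f * (f + 1ℤ) *_) zeroth) ⟩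
        0ℤ + - (f + f + 1ℤ) * 0ℤ + f * (f + 1ℤ) * 0ℤ
          ≡⟨ collapse f ⟩
        0ℤ ∎
        where
        open ≡-Reasoning
        open Weight f
        collapse : ∀ f → 0ℤ + - (f + f + 1ℤ) * 0ℤ + f * (f + 1ℤ) * 0ℤ ≡ 0ℤ
        collapse = solve-∀
        sum-zero : ∀ {g : Fin N → ℤ} → (∀ k → g k ≡ 0ℤ) → sum g ≡ 0ℤ
        sum-zero g≡0 = trans (sum-cong-≗ g≡0) (sum-0 N)
        -- `Spread` concerns pairs of distinct coordinates, so terms depending on fewer than two are
        -- given an arbitrary partner.
        off : ∀ k → ∃[ l ] k ≢ l
        off k with third k k
        ... | l , l≢k , _ = l , l≢k ∘ sym
        zeroth : ∑V.∑ (λ a → s₀ a * 1ℤ * ψ a) ≡ 0ℤ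
        zeroth with off k₀
        ... | l , k₀≢l = ∑-s₀ψ≡0 {λ _ → 1ℤ} k₀ l k₀≢l (λ _ → refl) (λ _ _ _ _ → refl)
        first : ∑[ k < N ] ∑V.∑ (λ a → s₀ a * z k a * ψ a) ≡ 0ℤ
        first = sum-zero λ k → let (l , k≢l) = off k in
          ∑-s₀ψ≡0 k l k≢l (z-resp k) (λ p≢k _ → z-fixed p≢k)
        zz-resp : ∀ k l → ∑V.Respects (λ a → z k a * z l a)
        zz-resp k l a≋b = cong₂ _*_ (z-resp k a≋b) (z-resp l a≋b)
        zz-fixed : ∀ {p k l} → p ≢ k → p ≢ l → FixedBy p (λ a → z k a * z l a)
        zz-fixed p≢k p≢l t a = cong₂ _*_ (z-fixed p≢k t a) (z-fixed p≢l t a)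
        second : ∑[ k < N ] ∑[ l < N ] ∑V.∑ (λ a → s₀ a * (z k a * z l a) * ψ a) ≡ 0ℤ
        second = sum-zero λ k → sum-zero λ l → case k l (k Finₚ.≟ l)
          where
          case : ∀ k l → Dec (k ≡ l) → ∑V.∑ (λ a → s₀ a * (z k a * z l a) * ψ a) ≡ 0ℤ
          case k l (no k≢l)   = ∑-s₀ψ≡0 k l k≢l (zz-resp k l) zz-fixed
          case k .k (yes refl) = let (l , k≢l) = off k in
            ∑-s₀ψ≡0 k l k≢l (zz-resp k k) (λ p≢k _ → zz-fixed p≢k p≢k)

    -- The weighted count over all pairs of code words

    module CodeBound (third : ∀ (k l : Fin N) → ∃[ p ] p ≢ k × p ≢ l) (k₀ : Fin N)
                     .{{_ : ℕ.NonZero q}} {c : ℕ} .{{_ : ℕ.NonZero c}} (q-1≡c : + q - 1ℤ ≡ + c)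
                     {m} (x : Fin m → V)
                     (spread : ∀ {i j} → i ≢ j → Spread (λ k → x i k R.- x j k))
                     (f : ℤ) where
      open Weight f

      ψ : Fin m → Fin m → V → ℤ
      ψ i j a = + q * 𝟙 (dot (x i) a) (dot (x j) a) - 1ℤ

      K : V → ℤ
      K a = ∑[ i < m ] ∑[ j < m ] ψ i j a

      K-resp : ∑V.Respects K
      K-resp a≋b = sum-cong-≗ λ i → sum-cong-≗ λ j →
        cong (λ y → + q * y - 1ℤ) (∑F.𝟙-cong (dot-cong (x i) a≋b) (dot-cong (x j) a≋b))

      -- q K(a) = Σ_s (q |{i : ⟨x i, a⟩ = s}| − m)².
      0≤K : ∀ a → 0ℤ ℤ.≤ K a
      0≤K a = ℤₚ.*-cancelˡ-≤-pos 0ℤ (K a) (+ q) {{positive (+<+ (ℕ.>-nonZero⁻¹ q))}}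
        (ℤₚ.≤-trans (ℤₚ.≤-reflexive (ℤₚ.*-zeroʳ (+ q)))
          (ℤₚ.≤-trans (sum-nonneg (λ s → S (F.from s) * S (F.from s)) (λ s → 0≤square (S (F.from s))))
            (ℤₚ.≤-reflexive squares)))
        where
        open ≡-Reasoning
        v : Fin m → Carrier
        v i = dot (x i) a
        u : Fin m → Carrier → ℤ
        u i s = + q * 𝟙 s (v i) - 1ℤ
        S : Carrier → ℤ
        S s = ∑[ i < m ] u i s
        ∑𝟙≡1 : ∀ y → ∑F.∑ (λ s → 𝟙 s y) ≡ 1ℤ
        ∑𝟙≡1 y = trans (sym (sum-*1 (λ s → 𝟙 (F.from s) y))) (∑F.∑-𝟙 {λ _ → 1ℤ} (λ _ → refl) y)
        expand : ∀ q y w → (q * y - 1ℤ) * (q * w - 1ℤ) ≡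
                 q * q * (y * w) + (- q * y + (- q * w + 1ℤ))
        expand = solve-∀
        collect : ∀ q y → q * q * y + (- q * 1ℤ + (- q * 1ℤ + q * 1ℤ)) ≡ q * (q * y - 1ℤ)
        collect = solve-∀
        cross : ∀ i j → ∑F.∑ (λ s → u i s * u j s) ≡ + q * ψ i j a
        cross i j = begin
          ∑F.∑ (λ s → u i s * u j s)
            ≡⟨ sum-cong-≗ (λ s → expand (+ q) (yᵢ s) (yⱼ s)) ⟩
          ∑[ s < q ] (+ q * + q * (yᵢ s * yⱼ s) + (- + q * yᵢ s + (- + q * yⱼ s + 1ℤ)))
            ≡⟨ ∑-distrib-+ (λ s → + q * + q * (yᵢ s * yⱼ s)) _ ⟩
          ∑[ s < q ] (+ q * + q * (yᵢ s * yⱼ s)) + ∑[ s < q ] (- + q * yᵢ s + (- + q * yⱼ s + 1ℤ))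
            ≡⟨ cong₂ _+_ (sym (*-distribˡ-sum (+ q * + q) (λ s → yᵢ s * yⱼ s)))
                 (trans (∑-distrib-+ (λ s → - + q * yᵢ s) _)
                   (cong₂ _+_ (sym (*-distribˡ-sum (- + q) yᵢ))
                     (trans (∑-distrib-+ (λ s → - + q * yⱼ s) _)
                       (cong₂ _+_ (sym (*-distribˡ-sum (- + q) yⱼ)) (sum-const q 1ℤ))))) ⟩
          + q * + q * ∑[ s < q ] (yᵢ s * yⱼ s) + (- + q * sum yᵢ + (- + q * sum yⱼ + + q * 1ℤ))
            ≡⟨ cong₂ (λ y w → + q * + q * y + w)
                 (∑F.∑-𝟙 {λ s → 𝟙 s (v j)} (λ s≈t → ∑F.𝟙-cong s≈t R.refl) (v i))
                 (cong₂ (λ y w → - + q * y + (- + q * w + + q * 1ℤ)) (∑𝟙≡1 (v i)) (∑𝟙≡1 (v j))) ⟩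
          + q * + q * 𝟙 (v i) (v j) + (- + q * 1ℤ + (- + q * 1ℤ + + q * 1ℤ))
            ≡⟨ collect (+ q) (𝟙 (v i) (v j)) ⟩
          + q * ψ i j a ∎
          where
          yᵢ yⱼ : Fin q → ℤ
          yᵢ s = 𝟙 (F.from s) (v i)
          yⱼ s = 𝟙 (F.from s) (v j)
        squares : ∑F.∑ (λ s → S s * S s) ≡ + q * K a
        squares = begin
          ∑F.∑ (λ s → S s * S s)
            ≡⟨ sum-cong-≗ (λ s → sum-square (λ i → u i (F.from s))) ⟩
          ∑F.∑ (λ s → ∑[ i < m ] ∑[ j < m ] (u i s * u j s))
            ≡⟨ ∑-comm (λ s i → ∑[ j < m ] (u i (F.from s) * u j (F.from s))) ⟩
          ∑[ i < m ] ∑F.∑ (λ s → ∑[ j < m ] (u i s * u j s))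
            ≡⟨ sum-cong-≗ (λ i → ∑-comm (λ s j → u i (F.from s) * u j (F.from s))) ⟩
          ∑[ i < m ] ∑[ j < m ] ∑F.∑ (λ s → u i s * u j s)
            ≡⟨ sum-cong-≗ (λ i → trans (sum-cong-≗ (cross i))
                 (sym (*-distribˡ-sum (+ q) (λ j → ψ i j a)))) ⟩
          ∑[ i < m ] (+ q * ∑[ j < m ] ψ i j a)
            ≡⟨ *-distribˡ-sum (+ q) (λ i → ∑[ j < m ] ψ i j a) ⟨
          + q * K a ∎

      -- Here `c` is q - 1. The hypothesis compares products instead of indices because the value is
      -- needed both for `i` equal to `j` and for every pair at `a` = 0.
      ψ-diagonal : ∀ {i j} a → dot (x i) a ≈ dot (x j) a → ψ i j a ≡ + c
      ψ-diagonal a eq = trans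
        (cong (λ y → + q * y - 1ℤ) (∑F.𝟙-refl eq))
        (trans (cong (_- 1ℤ) (ℤₚ.*-identityʳ (+ q))) q-1≡c)

      -- Equality of ⟨x i, a⟩ and ⟨x j, a⟩ is the vanishing of the product with the difference, so
      -- distinct words fall under orthogonality and only the diagonal survives.
      ∑-Wψ : ∀ i j → ∑V.∑ (λ a → W a * ψ i j a) ≡ ind j i * (+ c * ∑V.∑ W)
      ∑-Wψ i j with j Finₚ.≟ i
      ... | yes refl = begin
        ∑V.∑ (λ a → W a * ψ i i a)
          ≡⟨ sum-cong-≗ (λ k → trans (cong (W (VV.from k) *_) (ψ-diagonal {i} {i} (VV.from k) R.refl))
                                     (ℤₚ.*-comm (W (VV.from k)) (+ c))) ⟩
        ∑V.∑ (λ a → + c * W a)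
          ≡⟨ *-distribˡ-sum (+ c) (W ∘ VV.from) ⟨
        + c * ∑V.∑ W
          ≡⟨ ℤₚ.*-identityˡ _ ⟨
        1ℤ * (+ c * ∑V.∑ W) ∎
        where open ≡-Reasoning
      ... | no j≢i = begin
        ∑V.∑ (λ a → W a * ψ i j a)
          ≡⟨ sum-cong-≗ (λ k → cong (λ y → W (VV.from k) * (+ q * y - 1ℤ)) (difference (VV.from k))) ⟩
        ∑V.∑ (λ a → W a * (+ q * 𝟙 (dot (λ k → x i k R.- x j k) a) 0# - 1ℤ))
          ≡⟨ Orthogonality.∑-Wψ≡0 third (spread (j≢i ∘ sym)) k₀ f ⟩
        0ℤ ∎
        where
        open ≡-Reasoning
        difference : ∀ a → 𝟙 (dot (x i) a) (dot (x j) a) ≡ 𝟙 (dot (λ k → x i k R.- x j k) a) 0#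
        difference a = ∑F.𝟙-⇔
          (λ e → R.trans (dot-sub (x i) (x j) a) (x≈y⇒x∙y⁻¹≈ε e))
          (λ e → x∙y⁻¹≈ε⇒x≈y _ _ (R.trans (R.sym (dot-sub (x i) (x j) a)) e))

      ∑-WK : ∑V.∑ (λ a → W a * K a) ≡ + m * (+ c * ∑V.∑ W)
      ∑-WK = begin
        ∑V.∑ (λ a → W a * K a)
          ≡⟨ sum-cong-≗ (λ k → trans
               (*-distribˡ-sum (W (VV.from k)) (λ i → ∑[ j < m ] ψ i j (VV.from k)))
               (sum-cong-≗ λ i → *-distribˡ-sum (W (VV.from k)) (λ j → ψ i j (VV.from k)))) ⟩
        ∑V.∑ (λ a → ∑[ i < m ] ∑[ j < m ] (W a * ψ i j a))
          ≡⟨ ∑-comm (λ k i → ∑[ j < m ] (W (VV.from k) * ψ i j (VV.from k))) ⟩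
        ∑[ i < m ] ∑V.∑ (λ a → ∑[ j < m ] (W a * ψ i j a))
          ≡⟨ sum-cong-≗ (λ i → trans (∑-comm (λ k j → W (VV.from k) * ψ i j (VV.from k)))
               (trans (sum-cong-≗ (∑-Wψ i)) (sum-ind (λ _ → + c * ∑V.∑ W) i))) ⟩
        ∑[ i < m ] (+ c * ∑V.∑ W)
          ≡⟨ sum-const m _ ⟩
        + m * (+ c * ∑V.∑ W) ∎
        where open ≡-Reasoning

      -- At `a` = 0 all products vanish, so each of the m² pairs attains the maximal value q - 1.
      WK-0ᵛ : W (λ _ → 0#) * K (λ _ → 0#) ≡ P (+ N) * (+ m * (+ m * + c))
      WK-0ᵛ = cong₂ _*_
        (trans (cong₂ _*_ (∑F.𝟙-refl (dot-0ᵛ {N} (λ _ → 1#))) (cong P Z-0ᵛ)) (ℤₚ.*-identityˡ (P (+ N))))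
        (trans
          (sum-cong-≗ λ i → trans
            (sum-cong-≗ λ j → ψ-diagonal {i} {j} (λ _ → 0#)
              (R.trans (dot-0ᵛ (x i)) (R.sym (dot-0ᵛ (x j)))))
            (sum-const m (+ c)))
          (sum-const m (+ m * + c)))

      -- All terms of the sum of `W a * K a` are nonnegative, so the one at 0 is at most the whole.
      -- One side carries m² c and the other m c, and cancelling m c gives the bound.
      bounded : + m * P (+ N) ℤ.≤ ∑V.∑ W
      bounded = cancel m refl
        where
        P*m²c≤ : P (+ N) * (+ m * (+ m * + c)) ℤ.≤ + m * (+ c * ∑V.∑ W)
        P*m²c≤ = ℤₚ.≤-trans (ℤₚ.≤-reflexive (sym WK-0ᵛ))
          (ℤₚ.≤-trans
            (∑V.term≤∑ (λ a≋b → cong₂ _*_ (W-resp a≋b) (K-resp a≋b))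
              (λ a → 0≤* (0≤W a) (0≤K a)) (λ _ → 0#))
            (ℤₚ.≤-reflexive ∑-WK))
        rearrangeˡ : ∀ m c p → m * (c * (m * p)) ≡ p * (m * (m * c))
        rearrangeˡ = solve-∀
        -- For m = 0 nothing can be cancelled, but the claim is then that the total weight is
        -- nonnegative. The equation allows splitting on the module parameter `m`.
        cancel : ∀ m′ → m′ ≡ m → + m′ * P (+ N) ℤ.≤ ∑V.∑ W
        cancel ℕ.zero    _    = ℤₚ.≤-trans (ℤₚ.≤-reflexive (ℤₚ.*-zeroˡ (P (+ N))))
          (sum-nonneg (W ∘ VV.from) (0≤W ∘ VV.from))
        cancel (ℕ.suc _) refl = ℤₚ.*-cancelˡ-≤-pos _ _ (+ c) {{positive (+<+ (ℕ.>-nonZero⁻¹ c))}}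
          (ℤₚ.*-cancelˡ-≤-pos _ _ (+ m)
            (ℤₚ.≤-trans (ℤₚ.≤-reflexive (rearrangeˡ (+ m) (+ c) (P (+ N)))) P*m²c≤))

-- From distance greater than two to spread differences

module _ {c ℓ₁ ℓ₂} (F : HeytingField c ℓ₁ ℓ₂) {q} (card : HasCardinality (HeytingField.setoid F) q)
         (n : ℕ) where
  private
    module F = HeytingField F
    module R = CommutativeRing (HeytingCommutativeRing.commutativeRing F.heytingCommutativeRing)
  open PhaseRotation F n using (V; _≋_; graph)
  open Geometry F n
  open F using (Carrier; _≈_; 0#)
  open Linear.Counting (HeytingCommutativeRing.commutativeRing F.heytingCommutativeRing)
    card (n ℕ.+ 1) using (Spread)

  -- By contraposition: without a witness the extended difference is constant off {k, l}, so
  -- `x -ᵛ y` is a combination of two directions and the distance is at most two.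
  exceeds-two⇒spread : 3 ≤ n ℕ.+ 1 → ∀ {x y} → ¬ x ≋ y → DistanceExceeds graph 2 x y →
                       Spread (λ k → extend x k F.- extend y k)
  exceeds-two⇒spread 3≤N {x} {y} x≉y 2<dist k l k≢l ¬witness
    with two-directions 3≤N d d-last k≢l const
    where
    d : Vector Carrier (n ℕ.+ 1)
    d k = extend x k F.- extend y k
    d-last : d (n ↑ʳ zero) ≈ 0#
    d-last = R.trans
      (R.+-cong (R.reflexive (Vecₚ.lookup-++ʳ x (λ _ → 0#) zero))
                (R.-‿cong (R.reflexive (Vecₚ.lookup-++ʳ y (λ _ → 0#) zero))))
      (R.-‿inverseʳ 0#)
    const : ∀ p r → p ≢ k × p ≢ l → r ≢ k × r ≢ l → d p ≈ d r
    -- Tightness gives equality from the absence of apartness; an apartness would make the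
    -- difference invertible and supply the forbidden witness.
    const p r p∉ r∉ = proj₁ (F.tight (d p) (d r)) λ dp#dr →
      let (e , e-inverse , _) = F.#⇒invertible dp#dr in ¬witness (p , r , e , p∉ , r∉ , e-inverse)
  ... | s , t , eq = not-exceeds-two s t k l
    (λ i → R.trans
      (R.sym (R.+-cong (R.reflexive (Vecₚ.lookup-++ˡ x (λ _ → 0#) i))
                       (R.-‿cong (R.reflexive (Vecₚ.lookup-++ˡ y (λ _ → 0#) i)))))
      (eq i))
    x≉y 2<dist

-- The bound

≤-fraction : ∀ α Q num den .{{_ : ℕ.NonZero den}} → α * + den ℤ.≤ Q * num →
             α ℚ./ 1 ℚ.≤ (Q ℚ./ 1) ℚ.* (num ℚ./ den)
≤-fraction α Q num (ℕ.suc d) α*den≤ = ℚₚ.toℚᵘ-cancel-≤ (begin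
  ℚ.toℚᵘ (α ℚ./ 1)                                       ≃⟨ ℚₚ.toℚᵘ-fromℚᵘ (mkℚᵘ α 0) ⟩
  mkℚᵘ α 0                                               ≤⟨ *≤* cross ⟩
  mkℚᵘ Q 0 ℚᵘ.* mkℚᵘ num d                               ≃⟨ ℚᵘₚ.*-cong (ℚₚ.toℚᵘ-fromℚᵘ (mkℚᵘ Q 0))
                                                                           (ℚₚ.toℚᵘ-fromℚᵘ (mkℚᵘ num d)) ⟨
  ℚ.toℚᵘ (Q ℚ./ 1) ℚᵘ.* ℚ.toℚᵘ (num ℚ./ ℕ.suc d)         ≃⟨ ℚₚ.toℚᵘ-homo-* (Q ℚ./ 1) (num ℚ./ ℕ.suc d) ⟨
  ℚ.toℚᵘ ((Q ℚ./ 1) ℚ.* (num ℚ./ ℕ.suc d))               ∎)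
  where
  open ℚᵘₚ.≤-Reasoning
  -- `suc (d + 0)` is what the product of the denominators 1 and `suc d` computes to.
  cross : α * + (ℕ.suc (d ℕ.+ 0)) ℤ.≤ Q * num * + 1
  cross rewrite ℕₚ.+-identityʳ d | ℤₚ.*-identityʳ (Q * num) = α*den≤

-- This provides `X` = q^(n - 2) for the moments; `2 ≤ n` keeps the exponent from being truncated.
power-split : ∀ n q → 2 ≤ n →
              + (q ℕ.^ (n ℕ.+ 1)) ≡ + q * (+ q * (+ q * + (q ℕ.^ (n ℕ.∸ 2))))
power-split (ℕ.suc ℕ.zero)    q (s≤s ())
power-split (ℕ.suc (ℕ.suc n)) q _ rewrite ℕₚ.+-comm n 1 =
  trans (ℤₚ.pos-* q (q ℕ.* (q ℕ.* q ℕ.^ n))) (cong (+ q *_)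
    (trans (ℤₚ.pos-* q (q ℕ.* q ℕ.^ n)) (cong (+ q *_) (ℤₚ.pos-* q (q ℕ.^ n)))))

-- The right side is `P (+ N)`: as N - 1 = n, its factors are those of the denominator in the
-- opposite order.
denominator≡ : ∀ n f → f ≤ n → + ((n ℕ.∸ f) ℕ.* (n ℕ.+ 1 ℕ.∸ f)) ≡
               (+ (n ℕ.+ 1) - + f) * (+ (n ℕ.+ 1) - + f - 1ℤ)
denominator≡ n f f≤n = begin
  + ((n ℕ.∸ f) ℕ.* (n ℕ.+ 1 ℕ.∸ f))
    ≡⟨ ℤₚ.pos-* (n ℕ.∸ f) (n ℕ.+ 1 ℕ.∸ f) ⟩
  + (n ℕ.∸ f) * + (n ℕ.+ 1 ℕ.∸ f)
    ≡⟨ cong₂ _*_ (pos-∸ n f≤n) (pos-∸ (n ℕ.+ 1) (ℕₚ.≤-trans f≤n (ℕₚ.m≤m+n n 1))) ⟩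
  (+ n - + f) * (+ n + 1ℤ - + f)
    ≡⟨ rearrange (+ n) (+ f) ⟩
  (+ n + 1ℤ - + f) * (+ n + 1ℤ - + f - 1ℤ) ∎
  where
  open ≡-Reasoning
  pos-∸ : ∀ m → f ≤ m → + (m ℕ.∸ f) ≡ + m - + f
  pos-∸ m f≤m = sym (trans (ℤₚ.m-n≡m⊖n m f) (ℤₚ.⊖-≥ f≤m))
  rearrange : ∀ n f → (n - f) * (n + 1ℤ - f) ≡ (n + 1ℤ - f) * (n + 1ℤ - f - 1ℤ)
  rearrange = solve-∀

-- The left side is the total weight from `sum-W`; this polynomial identity extracts the factor `X`.
numerator≡ : ∀ n f q (X : ℤ) → let N = + (n ℕ.+ 1); qX = + q * X in
  N * (N * X + (qX - X)) + - (+ f + + f + 1ℤ) * (N * qX)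
    + + f * (+ f + 1ℤ) * (+ q * qX)
  ≡ X * (+ (n ℕ.* (n ℕ.+ 1)) ℤ.+
      + (f ℕ.* q) * (- + 2 - + (2 ℕ.* n) + + q + + (f ℕ.* q)))
numerator≡ n f q X = trans (rearrange (+ n) (+ f) (+ q) X)
  (cong (X *_) (sym (cong₂ _+_ (ℤₚ.pos-* n (n ℕ.+ 1)) (cong₂ _*_ (ℤₚ.pos-* f q)
    (cong₂ (λ 2n fq → - + 2 - 2n + + q + fq) (ℤₚ.pos-* 2 n) (ℤₚ.pos-* f q))))))
  where
  rearrange : ∀ n f q X →
    (n + 1ℤ) * ((n + 1ℤ) * X + (q * X - X))
      + - (f + f + 1ℤ) * ((n + 1ℤ) * (q * X)) + f * (f + 1ℤ) * (q * (q * X))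
    ≡ X * (n * (n + 1ℤ) + f * q * (- + 2 - + 2 * n + q + f * q))
  rearrange = solve-∀

theorem43 : ∀ {c ℓ₁ ℓ₂} (n q : ℕ) (2≤n : 2 ≤ n) (3≤q : 3 ≤ q) → IsPrimePower q →
    (F : HeytingField c ℓ₁ ℓ₂) → HasCardinality (HeytingField.setoid F) q →
    (α₂ : ℕ) → IsIndependenceNumber (PhaseRotation.graph F n) 2 α₂ →
    (+ α₂ ℚ./ 1) ℚ.≤ bound n q 2≤n 3≤q
theorem43 n (ℕ.suc ℕ.zero) 2≤n (s≤s ())
-- With `q` a double successor, q - 1 computes to a positive number, so the equation required of `c`
-- holds by `refl`.
theorem43 n q@(ℕ.suc (ℕ.suc _)) 2≤n 3≤q _ F card α₂ ((S , S-independent) , _) =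
  ≤-fraction (+ α₂) X (numerator n q 2≤n 3≤q) (denominator n q 2≤n 3≤q)
    {{denominator-nonZero n q 2≤n 3≤q}} (begin
      + α₂ * + denominator n q 2≤n 3≤q
        ≡⟨ cong (+ α₂ *_) (denominator≡ n f (m/n≤m n q)) ⟩
      + α₂ * P (+ N)
        ≤⟨ CodeBound.bounded third′ k₀ {q ℕ.∸ 1} refl (λ i → extend (S.to i)) spread (+ f) ⟩
      ∑V.∑ W
        ≡⟨ Moments.sum-W third′ X (power-split n q 2≤n) k₀ (+ f) ⟩
      _
        ≡⟨ numerator≡ n f q X ⟩
      X * numerator n q 2≤n 3≤q ∎)
  where
  open ℤₚ.≤-Reasoning
  R = HeytingCommutativeRing.commutativeRing (HeytingField.heytingCommutativeRing F)
  N f : ℕ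
  N = n ℕ.+ 1
  -- The mean N / q of `Z` on the hyperplane lies between the roots f and f + 1 of `P`. In terms of
  -- eigenvalues, q f - N ≤ -1 and q (f + 1) - N ≥ 0, so the roots are the neighbouring integers on
  -- either side.
  f = n / q
  X : ℤ
  X = + (q ℕ.^ (n ℕ.∸ 2))
  open Linear.Counting R card N
  open Weight (+ f) using (P; W)
  open Geometry F n using (extend)
  module S = Injection S
  3≤N : 3 ≤ N
  3≤N = ℕₚ.+-monoˡ-≤ 1 2≤n
  third′ = third 3≤N
  k₀ : Fin N
  k₀ = n ↑ʳ zero
  spread : ∀ {i j} → i ≢ j → Spread (λ k → HeytingField._-_ F (extend (S.to i) k) (extend (S.to j) k))
  spread {i} {j} i≢j = exceeds-two⇒spread F card n 3≤N to-i≉to-j (S-independent i j to-i≉to-j)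
    where
    to-i≉to-j = λ eq → i≢j (S.injective eq)
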